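{- Let $G$ be a connected 4-regular graph and let $v,w$ be adjacent vertices of $G$ such that the neighbours of $w$ are exactly $v,a,b,c$ and the neighbours of $v$ are exactly $w,d,e,f$, where $a,b,c,d,e,f$ are distinct. Let $R=G-\{v,w\}$. Then there is a fixed-point free involution on \[ \mathcal{R}_{\{a\},\{b,c,d,e,f\}} \cup \mathcal{R}_{\{b\},\{a,c,d,e,f\}} \cup \mathcal{R}_{\{c\},\{a,b,d,e,f\}} \cup \mathcal{R}_{\{d\},\{a,b,c,e,f\}} \cup \mathcal{R}_{\{e\},\{a,b,c,d,f\}} \cup \mathcal{R}_{\{f\},\{a,b,c,d,e\}}, \] and thus \[ r_{\{a\},\{b,c,d,e,f\}} + r_{\{b\},\{a,c,d,e,f\}} + r_{\{c\},\{a,b,d,e,f\}} + r_{\{d\},\{a,b,c,e,f\}} + r_{\{e\},\{a,b,c,d,f\}} + r_{\{f\},\{a,b,c,d,e\}} \equiv 0 \pmod 2. \]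
   Context: $G-\{v,w\}$ is the graph obtained by deleting $v,w$ and all incident edges. A spanning 2-forest of a graph is a spanning forest with exactly two trees. If $P=P_1\cup P_2$ is a bipartition of a set of vertices, a spanning 2-forest is compatible with $P$ if one of its trees contains all vertices of $P_1$ and none of $P_2$, and the other contains all vertices of $P_2$ and none of $P_1$. For a bipartition $P$ of $\{a,b,c,d,e,f\}$, $\mathcal{R}_P$ is the set of bipartitions $(\psi,\phi)$ of the edge set of $R$ such that $\psi$ is a spanning tree of $R$ and $\phi$ is a spanning 2-forest of $R$ compatible with $P$; $r_P=|\mathcal{R}_P|$. -}

module Defs where

open import Data.Nat using (ℕ; zero; suc; _+_)
open import Data.Nat.Divisibility using (_∣_)
open import Data.Fin using (Fin; _≟_)
open import Data.Fin.Subset using (Subset; _∈_; _∉_)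
open import Data.List using (List; []; _∷_; length; filter; allFin)
open import Data.List.Membership.Propositional using () renaming (_∈_ to _∈ₗ_)
open import Data.List.Relation.Unary.Unique.Propositional using (Unique)
open import Data.Product using (Σ; ∃; _×_; _,_; proj₁; proj₂)
open import Data.Sum using (_⊎_; inj₁; inj₂)
open import Data.Unit using (⊤)
open import Relation.Nullary using (¬_; Dec)
open import Relation.Nullary.Decidable using (_⊎-dec_)
open import Relation.Binary.PropositionalEquality using (_≡_; _≢_)

record Graph : Set where
  field
    n        : ℕ
    m        : ℕ
    ends     : Fin m → Fin n × Fin n
    loopless : ∀ e → proj₁ (ends e) ≢ proj₂ (ends e)

module _ (G : Graph) where
  open Graph G

  Vertex : Set
  Vertex = Fin n

  Edge : Set
  Edge = Fin m

  Link : Edge → Vertex → Vertex → Set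
  Link e x y = (proj₁ (ends e) ≡ x × proj₂ (ends e) ≡ y) ⊎ (proj₁ (ends e) ≡ y × proj₂ (ends e) ≡ x)

  Adj : Vertex → Vertex → Set
  Adj x y = ∃ λ e → Link e x y

  Incident : Vertex → Edge → Set
  Incident x e = (proj₁ (ends e) ≡ x) ⊎ (proj₂ (ends e) ≡ x)

  incident? : (x : Vertex) → (e : Edge) → Dec (Incident x e)
  incident? x e = (proj₁ (ends e) ≟ x) ⊎-dec (proj₂ (ends e) ≟ x)

  degree : Vertex → ℕ
  degree x = length (filter (incident? x) (allFin m))

  FourRegular : Set
  FourRegular = ∀ x → degree x ≡ 4

  data Reach (S : Edge → Set) : Vertex → Vertex → Set where
    here : ∀ {x} → Reach S x x
    step : ∀ {x y z} (e : Edge) → S e → Link e x y → Reach S y z → Reach S x z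

  Connected : Set
  Connected = ∀ x y → Reach (λ _ → ⊤) x y

  Acyclic : (Edge → Set) → Set
  Acyclic S = ∀ e → S e → ¬ Reach (λ f → S f × f ≢ e) (proj₁ (ends e)) (proj₂ (ends e))

  module Deleted (v w : Vertex) where

    VR : Vertex → Set
    VR x = x ≢ v × x ≢ w

    ER : Edge → Set
    ER e = VR (proj₁ (ends e)) × VR (proj₂ (ends e))

    SpanningTree : (Edge → Set) → Set
    SpanningTree S = (∀ e → S e → ER e)
                   × (∀ x y → VR x → VR y → Reach S x y)
                   × Acyclic S

    Compatible2Forest : List Vertex → List Vertex → (Edge → Set) → Set
    Compatible2Forest P₁ P₂ S =
        (∀ e → S e → ER e)
      × Acyclic S
      × Σ Vertex λ x → Σ Vertex λ y →
            VR x × VR y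
          × ¬ Reach S x y
          × (∀ z → VR z → Reach S z x ⊎ Reach S z y)
          × (∀ z → z ∈ₗ P₁ → Reach S z x)
          × (∀ z → z ∈ₗ P₂ → Reach S z y)

    Rest : Subset m → Edge → Set
    Rest ψ e = ER e × e ∉ ψ

    -- membership of the bipartition (ψ , E(R) ∖ ψ) in 𝓡_P
    -- (an edge bipartition is determined by its first part ψ ⊆ E(R))
    InR : List Vertex → List Vertex → Subset m → Set
    InR P₁ P₂ ψ = SpanningTree (λ e → e ∈ ψ) × Compatible2Forest P₁ P₂ (Rest ψ)

IsCount : {A : Set} → (A → Set) → ℕ → Set
IsCount {A} P k = Σ (List A) λ xs → Unique xs × (∀ a → (P a → a ∈ₗ xs) × (a ∈ₗ xs → P a)) × length xs ≡ k

{-# OPTIONS --safe #-}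
module Submission where

open import Defs
open import Algebra.Bundles using (CommutativeRing)
open import Data.Bool using (Bool; true; false; not; _∧_; _∨_; _xor_) renaming (_≟_ to _≟ᵇ_)
open import Data.Bool.Properties using (¬-not; not-involutive; not-injective; not-distribˡ-xor; xor-comm; xor-assoc; xor-identityʳ; xor-same; ∧-zeroʳ; ∧-identityʳ; ∧-comm; ∧-assoc; ∧-idem; ∧-distribˡ-xor; xor-∧-commutativeRing; ∨-identityʳ; ∨-zeroʳ)
open import Data.Empty using (⊥; ⊥-elim)
open import Data.Fin using (Fin; zero; suc; toℕ; _≟_)
open import Data.Fin.Properties using (all?; any?; suc-injective)
open import Data.Fin.Subset using (Subset) renaming (_∈_ to _∈ˢ_; _∉_ to _∉ˢ_)
open import Data.List using (List; []; _∷_; length; map; _++_; filter; allFin) renaming (tabulate to tabulateₗ)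
open import Data.List.Membership.Propositional using () renaming (_∈_ to _∈ₗ_)
open import Data.List.Membership.Propositional.Properties using (∈-map⁺; ∈-map⁻; ∈-++⁺ˡ; ∈-++⁺ʳ; ∈-allFin; ∈-filter⁺; ∈-filter⁻)
open import Data.List.Relation.Unary.All using ([]; _∷_)
import Data.List.Relation.Unary.All as All
open import Data.List.Relation.Unary.AllPairs using ([]; _∷_)
open import Data.List.Relation.Unary.Any using (here; there)
open import Data.List.Relation.Unary.Unique.Propositional using (Unique)
open import Data.List.Relation.Unary.Unique.Propositional.Properties using (map⁺; ++⁺; filter⁺; Unique[x∷xs]⇒x∉xs)
open import Data.Nat using (ℕ; zero; suc; _+_; _*_; _≤_; z≤n; _<ᵇ_)
open import Data.Nat.Divisibility using (_∣_; divides)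
open import Data.Nat.Properties using (+-*-semiring; +-mono-≤; +-monoʳ-≤; +-cancelˡ-≡; +-cancelʳ-≤; +-identityʳ; *-assoc; *-comm; *-identityʳ; *-cancelˡ-≡; *-distribʳ-+; *-distribˡ-+; ≤-antisym; ≤-refl; ≤-trans; ≤-reflexive)
open import Data.Nat.Solver using (module +-*-Solver)
open import Data.Product using (Σ; ∃; _×_; _,_; proj₁; proj₂)
open import Data.Sum using (_⊎_; inj₁; inj₂; [_,_]′)
open import Data.Vec using (Vec; []; _∷_; lookup; tabulate; zipWith; _[_]≔_)
open import Data.Vec.Properties using (≡-dec; ∷-injectiveʳ; []=⇒lookup; lookup⇒[]=; lookup∘update; lookup∘update′; lookup∘tabulate; lookup-zipWith; lookup-map)
open import Function using (_∘_)
open import Relation.Binary.PropositionalEquality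
open import Relation.Nullary using (Dec; does; yes; no; ¬_)
open import Relation.Nullary.Decidable using (dec-true; dec-false; toWitness; _×-dec_; _→-dec_; _⊎-dec_; ¬?) renaming (map′ to Dec-map)
open import Algebra.Properties.Semiring.Sum (CommutativeRing.semiring xor-∧-commutativeRing) using (sum; sum-cong-≗; ∑-distrib-+; ∑-comm; *-distribˡ-sum; *-distribʳ-sum; sum-replicate-zero)
import Algebra.Properties.Semiring.Sum +-*-semiring as ℕΣ
open import Algebra.Properties.CommutativeSemigroup (CommutativeRing.+-commutativeSemigroup xor-∧-commutativeRing) using () renaming (interchange to xor-interchange)

-- Write R = G − {v, w}.  For a set S of edges of R let κ S be the 𝔽₂-valued function on vertices that
-- vanishes exactly on the component of a in S, and let δχ e ∈ 𝔽₂ be the change of χ across e.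
-- For a spanning tree S the functions κ (S ∖ g), g ∈ S, form the basis dual to S, so exchange arguments
-- become linear algebra over 𝔽₂ (`expand`, `unique`).
--
-- Let (ψ, φ) be a state: ψ a spanning tree, φ its complement, a 2-forest; let A be the tree of φ avoiding a,
-- s the number of the six special vertices in A, k the number of edges of ψ leaving A, and e(ψ), e(φ) the
-- numbers of edges of ψ, φ inside A.  Summing degrees over A gives k + 2(e(ψ) + e(φ)) + s = 4|A|, and
-- e(φ) = |A| − 1.  So k ≡ s (mod 2), and for odd s, s ≡ 1 (mod 4) iff C(k,2) + e(ψ) + |A| + 1 is odd.
-- The condition s ≡ 1 (mod 4) means s ∈ {1, 5}, which is membership in the union of the theorem.  Hence it
-- suffices that, modulo 2, each of the following sums over the states with k odd vanishes:
--   Σ 1 and Σ |A|, by the exchange (ψ, φ) ↦ (φ + f, ψ − f) for the k edges f of ψ leaving A;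
--   Σ e(ψ), because each edge of ψ inside A can be exchanged with an odd number of edges of φ inside A;
--   Σ C(k,2), where a pair {e, f} is ordered by means of the least edge on the cycle of φ + e + f, after
--   which, for each fixed e, the admissible f form the intersection of a cycle with a cut.
-- The involution is then any pairing of the even number of elements.


-- Boolean identities and decidable equality

infix 7 _==_

_==_ : ∀ {n} → Fin n → Fin n → Bool
i == j = does (i ≟ j)

==-refl : ∀ {n} (i : Fin n) → i == i ≡ true
==-refl i = dec-true (i ≟ i) refl

==-≢ : ∀ {n} {i j : Fin n} → i ≢ j → i == j ≡ false
==-≢ {i = i} {j} = dec-false (i ≟ j)

does⇒ : ∀ {P : Set} (P? : Dec P) → does P? ≡ true → P
does⇒ (yes p) _ = p

does-⇔ : ∀ {P Q : Set} (P? : Dec P) (Q? : Dec Q) → (P → Q) → (Q → P) → does P? ≡ does Q?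
does-⇔ (yes p) Q? f g = sym (dec-true Q? (f p))
does-⇔ (no ¬p) Q? f g = sym (dec-false Q? (¬p ∘ g))

≡-by-true : ∀ {x y : Bool} → (x ≡ true → y ≡ true) → (y ≡ true → x ≡ true) → x ≡ y
≡-by-true {true}  f g = sym (f refl)
≡-by-true {false} {false} f g = refl
≡-by-true {false} {true} f g = g refl

∧-true : ∀ {x y} → x ∧ y ≡ true → x ≡ true × y ≡ true
∧-true {true} p = refl , p

∧-intro : ∀ {x y} → x ≡ true → y ≡ true → x ∧ y ≡ true
∧-intro refl refl = refl

∧-cong-true : ∀ {x y z} → (x ≡ true → y ≡ z) → x ∧ y ≡ x ∧ z
∧-cong-true {true} f = f refl
∧-cong-true {false} f = refl

xor-cancelʳ : ∀ a b c → (a xor c) xor (b xor c) ≡ a xor b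
xor-cancelʳ a b c =
  trans (xor-interchange a c b c) (trans (cong ((a xor b) xor_) (xor-same c)) (xor-identityʳ (a xor b)))

false≢true : false ≢ true
false≢true ()

xor-false : ∀ {x y} → x xor y ≡ false → x ≡ y
xor-false {false} p = sym p
xor-false {true} {true} p = refl

xor-true : ∀ {x y} → x ≢ y → x xor y ≡ true
xor-true {false} {false} p = ⊥-elim (p refl)
xor-true {false} {true}  p = refl
xor-true {true}  {false} p = refl
xor-true {true}  {true}  p = ⊥-elim (p refl)

∧-swap : ∀ a b c → a ∧ (b ∧ c) ≡ b ∧ (a ∧ c)
∧-swap false false c = refl
∧-swap false true  c = refl
∧-swap true  b     c = refl

∧-xor² : ∀ a b c d → (a ∧ (b ∧ c)) xor (a ∧ (b ∧ d)) ≡ a ∧ (b ∧ (c xor d))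
∧-xor² false b     c d = refl
∧-xor² true  false c d = refl
∧-xor² true  true  c d = refl

-- Sums over 𝔽₂

sum-false : ∀ {n} {f : Fin n → Bool} → (∀ i → f i ≡ false) → sum f ≡ false
sum-false {n} f≡0 = trans (sum-cong-≗ f≡0) (sum-replicate-zero n)

sum-single : ∀ {n} (i : Fin n) (f : Fin n → Bool) → (∀ j → j ≢ i → f j ≡ false) → sum f ≡ f i
sum-single zero f p =
  trans (cong (f zero xor_) (sum-false λ j → p (suc j) λ ())) (xor-identityʳ _)
sum-single (suc i) f p =
  cong₂ _xor_ (p zero λ ()) (sum-single i (f ∘ suc) λ j j≢i → p (suc j) (j≢i ∘ suc-injective))

sum-true⇒∃ : ∀ {n} (f : Fin n → Bool) → sum f ≡ true → ∃ λ i → f i ≡ true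
sum-true⇒∃ {suc n} f p with f zero in eq
... | true  = zero , eq
... | false with i , q ← sum-true⇒∃ (f ∘ suc) p = suc i , q

-- Off-diagonal entries cancel in transposed pairs. The induction removes the first row and the
-- first column, which have equal sums.
sum-symmetric : ∀ {n} (M : Fin n → Fin n → Bool) → (∀ i j → M i j ≡ M j i) → (∀ i → M i i ≡ false) →
                sum (λ i → sum (M i)) ≡ false
sum-symmetric {zero} M sy di = refl
sum-symmetric {suc n} M sy di = begin
  (M zero zero xor r) xor sum (λ i → M (suc i) zero xor sum (λ j → M (suc i) (suc j)))
    ≡⟨ cong₂ _xor_ (cong (_xor r) (di zero)) (∑-distrib-+ (λ i → M (suc i) zero) _) ⟩
  r xor (sum (λ i → M (suc i) zero) xor sum (λ i → sum (λ j → M (suc i) (suc j))))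
    ≡⟨ cong (r xor_) (cong₂ _xor_ (sum-cong-≗ λ i → sy (suc i) zero)
         (sum-symmetric (λ i j → M (suc i) (suc j)) (λ i j → sy (suc i) (suc j)) (di ∘ suc))) ⟩
  r xor (r xor false) ≡⟨ cong (r xor_) (xor-identityʳ r) ⟩
  r xor r ≡⟨ xor-same r ⟩
  false ∎
  where
  open ≡-Reasoning
  r = sum (λ j → M zero (suc j))

infix 7 _<₂_

_<₂_ : ∀ {n} → Fin n → Fin n → Bool
i <₂ j = toℕ i <ᵇ toℕ j

<₂-total : ∀ {n} (i j : Fin n) → (i <₂ j) xor (j <₂ i) ≡ not (i == j)
<₂-total zero zero = refl
<₂-total zero (suc j) = refl
<₂-total (suc i) zero = refl
<₂-total (suc i) (suc j) with i ≟ j | <₂-total i j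
... | yes p | q = q
... | no p | q = q

-- Renaming the indices in the half with `Y j i` turns `i <₂ j` into `j <₂ i`, and the two order
-- relations add up to `i ≠ j`. This converts a sum over unordered pairs into one over ordered
-- pairs, in which each index can be fixed in turn.
sum-ordered-pairs : ∀ {n} (Y : Fin n → Fin n → Bool) →
  sum (λ i → sum λ j → i <₂ j ∧ (Y i j xor Y j i)) ≡ sum (λ i → sum λ j → not (i == j) ∧ Y i j)
sum-ordered-pairs Y = begin
  sum (λ i → sum λ j → i <₂ j ∧ (Y i j xor Y j i))
    ≡⟨ sum-cong-≗ (λ i → trans (sum-cong-≗ λ j → ∧-distribˡ-xor (i <₂ j) (Y i j) (Y j i))
                               (∑-distrib-+ (λ j → i <₂ j ∧ Y i j) _)) ⟩
  sum (λ i → sum (λ j → i <₂ j ∧ Y i j) xor sum (λ j → i <₂ j ∧ Y j i))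
    ≡⟨ ∑-distrib-+ (λ i → sum (λ j → i <₂ j ∧ Y i j)) _ ⟩
  sum (λ i → sum (λ j → i <₂ j ∧ Y i j)) xor sum (λ i → sum (λ j → i <₂ j ∧ Y j i))
    ≡⟨ cong (sum (λ i → sum (λ j → i <₂ j ∧ Y i j)) xor_) (∑-comm λ i j → i <₂ j ∧ Y j i) ⟩
  sum (λ i → sum (λ j → i <₂ j ∧ Y i j)) xor sum (λ i → sum (λ j → j <₂ i ∧ Y i j))
    ≡⟨ ∑-distrib-+ (λ i → sum (λ j → i <₂ j ∧ Y i j)) _ ⟨
  sum (λ i → sum (λ j → i <₂ j ∧ Y i j) xor sum (λ j → j <₂ i ∧ Y i j))
    ≡⟨ sum-cong-≗ (λ i → trans (sym (∑-distrib-+ (λ j → i <₂ j ∧ Y i j) _)) (sum-cong-≗ λ j → pointwise i j)) ⟩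
  sum (λ i → sum λ j → not (i == j) ∧ Y i j) ∎
  where
  open ≡-Reasoning
  factor : ∀ x y z → (x ∧ z) xor (y ∧ z) ≡ (x xor y) ∧ z
  factor false y z = refl
  factor true false z = xor-identityʳ z
  factor true true z = xor-same z
  pointwise : ∀ i j → (i <₂ j ∧ Y i j) xor (j <₂ i ∧ Y i j) ≡ not (i == j) ∧ Y i j
  pointwise i j = trans (factor (i <₂ j) (j <₂ i) (Y i j)) (cong (_∧ Y i j) (<₂-total i j))

-- Counts modulo 4

⟦_⟧ : Bool → ℕ
⟦ true ⟧ = 1
⟦ false ⟧ = 0

-- The parity of C(k,2), where k is the number of true values.
pairs : ∀ {n} → (Fin n → Bool) → Bool
pairs b = sum λ i → sum λ j → i <₂ j ∧ (b i ∧ b j)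

pairs-suc : ∀ {n} (b : Fin (suc n) → Bool) → pairs b ≡ (b zero ∧ sum (b ∘ suc)) xor pairs (b ∘ suc)
pairs-suc b = cong (_xor pairs (b ∘ suc)) (sym (*-distribˡ-sum (b zero) (b ∘ suc)))

-- The two lowest binary digits of k are the parities of k and of C(k,2). One more true value raises
-- C(k,2) by k, which is exactly the carry from the lowest digit to the next.
count-mod4 : ∀ {n} (b : Fin n → Bool) →
  ∃ λ q → ℕΣ.sum (⟦_⟧ ∘ b) ≡ ⟦ sum b ⟧ + 2 * ⟦ pairs b ⟧ + 4 * q
count-mod4 {zero} b = 0 , refl
count-mod4 {suc n} b with q , eq ← count-mod4 (b ∘ suc) rewrite eq | pairs-suc b
  with b zero | sum (b ∘ suc) | pairs (b ∘ suc)
... | false | _     | _     = q , refl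
... | true  | false | false = q , refl
... | true  | false | true  = q , refl
... | true  | true  | false = q , refl
-- Here k ≡ 3 (mod 4), and the carry runs through both digits into `q`.
... | true  | true  | true  = suc q , solve 1 (λ q → con 4 :+ con 4 :* q := con 4 :* (con 1 :+ q)) refl q
  where open +-*-Solver using (solve; _:+_; _:*_; _:=_; con)

-- Sums over all Boolean vectors

Σᵥ : ∀ {m} → (Vec Bool m → Bool) → Bool
Σᵥ {zero}  F = F []
Σᵥ {suc m} F = Σᵥ (F ∘ (false ∷_)) xor Σᵥ (F ∘ (true ∷_))

Σᵥ-cong : ∀ {m} {F H : Vec Bool m → Bool} → (∀ v → F v ≡ H v) → Σᵥ F ≡ Σᵥ H
Σᵥ-cong {zero}  p = p []
Σᵥ-cong {suc m} p = cong₂ _xor_ (Σᵥ-cong (p ∘ (false ∷_))) (Σᵥ-cong (p ∘ (true ∷_)))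

Σᵥ-false : ∀ m → Σᵥ {m} (λ _ → false) ≡ false
Σᵥ-false zero    = refl
Σᵥ-false (suc m) = cong₂ _xor_ (Σᵥ-false m) (Σᵥ-false m)

Σᵥ-xor : ∀ {m} (F H : Vec Bool m → Bool) → Σᵥ (λ v → F v xor H v) ≡ Σᵥ F xor Σᵥ H
Σᵥ-xor {zero}  F H = refl
Σᵥ-xor {suc m} F H = trans (cong₂ _xor_ (Σᵥ-xor (F ∘ (false ∷_)) _) (Σᵥ-xor (F ∘ (true ∷_)) _))
                           (xor-interchange (Σᵥ (F ∘ (false ∷_))) _ _ _)

Σᵥ-sum : ∀ {m n} (F : Vec Bool m → Fin n → Bool) → Σᵥ (λ v → sum (F v)) ≡ sum (λ i → Σᵥ (λ v → F v i))
Σᵥ-sum {m} {zero}  F = Σᵥ-false m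
Σᵥ-sum {m} {suc n} F = trans (Σᵥ-xor (λ v → F v zero) _)
                             (cong (Σᵥ (λ v → F v zero) xor_) (Σᵥ-sum λ v i → F v (suc i)))

infixl 6 _⊕_

_⊕_ : ∀ {m} → Vec Bool m → Vec Bool m → Vec Bool m
_⊕_ = zipWith _xor_

-- Translation by `u` permutes the cube; a true leading bit of `u` interchanges the two halves.
Σᵥ-shift : ∀ {m} (F : Vec Bool m → Bool) (u : Vec Bool m) → Σᵥ (λ v → F (v ⊕ u)) ≡ Σᵥ F
Σᵥ-shift F []          = refl
Σᵥ-shift F (false ∷ u) = cong₂ _xor_ (Σᵥ-shift (F ∘ (false ∷_)) u) (Σᵥ-shift (F ∘ (true ∷_)) u)
Σᵥ-shift F (true ∷ u)  = trans (cong₂ _xor_ (Σᵥ-shift (F ∘ (true ∷_)) u) (Σᵥ-shift (F ∘ (false ∷_)) u))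
                               (xor-comm (Σᵥ (F ∘ (true ∷_))) _)

-- Translation by a nonzero `u` is a fixed-point free involution of the cube, so the values of an
-- invariant `F` cancel in pairs; `i` witnesses `u ≠ 0`. Below, every pairing of states is made into
-- such a translation.
Σᵥ-shift-invariant : ∀ {m} (F : Vec Bool m → Bool) (u : Vec Bool m) (i : Fin m) → lookup u i ≡ true →
                     (∀ v → F (v ⊕ u) ≡ F v) → Σᵥ F ≡ false
Σᵥ-shift-invariant F (true ∷ u) zero _ inv =
  trans (cong (_xor Σᵥ (F ∘ (true ∷_))) (trans (sym (Σᵥ-cong (inv ∘ (false ∷_)))) (Σᵥ-shift (F ∘ (true ∷_)) u)))
        (xor-same (Σᵥ (F ∘ (true ∷_))))
Σᵥ-shift-invariant F (false ∷ u) (suc i) p inv =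
  cong₂ _xor_ (Σᵥ-shift-invariant (F ∘ (false ∷_)) u i p (inv ∘ (false ∷_)))
              (Σᵥ-shift-invariant (F ∘ (true ∷_)) u i p (inv ∘ (true ∷_)))
Σᵥ-shift-invariant F (true ∷ u) (suc i) p inv =
  trans (cong (_xor Σᵥ (F ∘ (true ∷_))) (trans (sym (Σᵥ-cong (inv ∘ (false ∷_)))) (Σᵥ-shift (F ∘ (true ∷_)) u)))
        (xor-same (Σᵥ (F ∘ (true ∷_))))

-- Parity of the length of an enumeration

_≟ᵥ_ : ∀ {m} (u v : Vec Bool m) → Dec (u ≡ v)
_≟ᵥ_ = ≡-dec _≟ᵇ_

Σᵥ-indicator : ∀ {m} (u : Vec Bool m) → Σᵥ (λ v → does (u ≟ᵥ v)) ≡ true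
Σᵥ-indicator [] = refl
Σᵥ-indicator {suc m} (false ∷ u) = cong₂ _xor_
  (trans (Σᵥ-cong λ v → does-⇔ ((false ∷ u) ≟ᵥ (false ∷ v)) (u ≟ᵥ v) ∷-injectiveʳ (cong (false ∷_))) (Σᵥ-indicator u))
  (trans (Σᵥ-cong λ v → dec-false ((false ∷ u) ≟ᵥ (true ∷ v)) λ ()) (Σᵥ-false m))
Σᵥ-indicator {suc m} (true ∷ u) = cong₂ _xor_
  (trans (Σᵥ-cong λ v → dec-false ((true ∷ u) ≟ᵥ (false ∷ v)) λ ()) (Σᵥ-false m))
  (trans (Σᵥ-cong λ v → does-⇔ ((true ∷ u) ≟ᵥ (true ∷ v)) (u ≟ᵥ v) ∷-injectiveʳ (cong (true ∷_))) (Σᵥ-indicator u))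

odd : ℕ → Bool
odd zero    = false
odd (suc n) = not (odd n)

odd-+ : ∀ m n → odd (m + n) ≡ odd m xor odd n
odd-+ zero n = refl
odd-+ (suc m) n = trans (cong not (odd-+ m n)) (not-distribˡ-xor (odd m) (odd n))

even⇒2∣ : ∀ n → odd n ≡ false → 2 ∣ n
even⇒2∣ zero          _ = divides 0 refl
even⇒2∣ (suc (suc n)) p with divides q eq ← even⇒2∣ n (trans (sym (not-involutive (odd n))) p) =
  divides (suc q) (cong (2 +_) eq)

occurrences : ∀ {m} → List (Vec Bool m) → Vec Bool m → Bool
occurrences []       v = false
occurrences (x ∷ xs) v = does (x ≟ᵥ v) xor occurrences xs v

occurrences-∉ : ∀ {m} {xs : List (Vec Bool m)} {v} → ¬ v ∈ₗ xs → occurrences xs v ≡ false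
occurrences-∉ {xs = []} _ = refl
occurrences-∉ {xs = x ∷ xs} {v} v∉ =
  cong₂ _xor_ (dec-false (x ≟ᵥ v) λ p → v∉ (here (sym p))) (occurrences-∉ (v∉ ∘ there))

occurrences-∈ : ∀ {m} {xs : List (Vec Bool m)} {v} → Unique xs → v ∈ₗ xs → occurrences xs v ≡ true
occurrences-∈ {xs = x ∷ xs} {v} un@(_ ∷ _) (here refl) =
  cong₂ _xor_ (dec-true (x ≟ᵥ x) refl) (occurrences-∉ (Unique[x∷xs]⇒x∉xs un))
occurrences-∈ {xs = x ∷ xs} {v} un@(_ ∷ un′) (there v∈) =
  cong₂ _xor_ (dec-false (x ≟ᵥ v) λ { refl → Unique[x∷xs]⇒x∉xs un v∈ }) (occurrences-∈ un′ v∈)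

Σᵥ-occurrences : ∀ {m} (xs : List (Vec Bool m)) → Σᵥ (occurrences xs) ≡ odd (length xs)
Σᵥ-occurrences {m} []   = Σᵥ-false m
Σᵥ-occurrences (x ∷ xs) = trans (Σᵥ-xor (λ v → does (x ≟ᵥ v)) (occurrences xs))
                                (cong₂ _xor_ (Σᵥ-indicator x) (Σᵥ-occurrences xs))

-- Without repetitions `occurrences xs` is the indicator of `P`. This links enumerations by lists
-- with sums over the cube.
odd-length : ∀ {m} {P : Vec Bool m → Set} (P? : ∀ v → Dec (P v)) (xs : List (Vec Bool m)) → Unique xs →
             (∀ v → (P v → v ∈ₗ xs) × (v ∈ₗ xs → P v)) → odd (length xs) ≡ Σᵥ (λ v → does (P? v))
odd-length P? xs un mem = trans (sym (Σᵥ-occurrences xs)) (Σᵥ-cong pointwise)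
  where
  pointwise : ∀ v → occurrences xs v ≡ does (P? v)
  pointwise v with P? v
  ... | yes p = occurrences-∈ un (proj₁ (mem v) p)
  ... | no ¬p = occurrences-∉ (¬p ∘ proj₂ (mem v))

-- Listing the cube and pairing the entries of a list

allVecs : ∀ m → List (Vec Bool m)
allVecs zero    = [] ∷ []
allVecs (suc m) = map (false ∷_) (allVecs m) ++ map (true ∷_) (allVecs m)

∈-allVecs : ∀ {m} (v : Vec Bool m) → v ∈ₗ allVecs m
∈-allVecs []          = here refl
∈-allVecs (false ∷ v) = ∈-++⁺ˡ (∈-map⁺ (false ∷_) (∈-allVecs v))
∈-allVecs (true ∷ v)  = ∈-++⁺ʳ (map (false ∷_) (allVecs _)) (∈-map⁺ (true ∷_) (∈-allVecs v))

allVecs-unique : ∀ m → Unique (allVecs m)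
allVecs-unique zero    = [] ∷ []
allVecs-unique (suc m) = ++⁺ (map⁺ ∷-injectiveʳ (allVecs-unique m)) (map⁺ ∷-injectiveʳ (allVecs-unique m)) disjoint
  where
  disjoint : ∀ {v} → ¬ (v ∈ₗ map (false ∷_) (allVecs m) × v ∈ₗ map (true ∷_) (allVecs m))
  disjoint (p , q) with ∈-map⁻ (false ∷_) p | ∈-map⁻ (true ∷_) q
  ... | _ , _ , refl | _ , _ , ()

-- Consecutive entries are matched two by two. The last clause serves only vectors outside the list
-- and the last entry of a list of odd length.
partner : ∀ {m} → List (Vec Bool m) → Vec Bool m → Vec Bool m
partner (x ∷ y ∷ xs) v with x ≟ᵥ v | y ≟ᵥ v
... | yes _ | _     = y
... | no _  | yes _ = x
... | no _  | no _  = partner xs v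
partner _ v = v

-- Without repetitions, the partner of an entry of the tail differs from the first two entries, so
-- the second lookup passes over them as the first did. Even length leaves no entry unmatched.
partner-involution : ∀ {m} (xs : List (Vec Bool m)) → Unique xs → odd (length xs) ≡ false → ∀ {v} → v ∈ₗ xs →
  partner xs v ∈ₗ xs × partner xs (partner xs v) ≡ v × partner xs v ≢ v
partner-involution (x ∷ y ∷ xs) un@((x≢y ∷ x≢) ∷ un′@(_ ∷ un″)) even {v} v∈ with x ≟ᵥ v | y ≟ᵥ v
... | yes refl | _ with x ≟ᵥ y | y ≟ᵥ y
...   | yes x≡y | _ = ⊥-elim (x≢y x≡y)
...   | no _ | yes _ = there (here refl) , refl , x≢y ∘ sym
...   | no _ | no y≢y = ⊥-elim (y≢y refl)
partner-involution (x ∷ y ∷ xs) un@((x≢y ∷ x≢) ∷ un′@(_ ∷ un″)) even {v} v∈ | no _ | yes refl with x ≟ᵥ x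
...   | yes _ = here refl , refl , x≢y
...   | no x≢x = ⊥-elim (x≢x refl)
partner-involution (x ∷ y ∷ xs) un@((x≢y ∷ x≢) ∷ un′@(_ ∷ un″)) even {v} (here v≡x) | no x≢v | no y≢v = ⊥-elim (x≢v (sym v≡x))
partner-involution (x ∷ y ∷ xs) un@((x≢y ∷ x≢) ∷ un′@(_ ∷ un″)) even {v} (there (here v≡y)) | no x≢v | no y≢v = ⊥-elim (y≢v (sym v≡y))
partner-involution (x ∷ y ∷ xs) un@((x≢y ∷ x≢) ∷ un′@(_ ∷ un″)) even {v} (there (there v∈)) | no x≢v | no y≢v
  with partner-involution xs un″ (trans (sym (not-involutive _)) even) v∈
... | p∈ , inv , free with x ≟ᵥ partner xs v | y ≟ᵥ partner xs v
...   | yes refl | _ = ⊥-elim (Unique[x∷xs]⇒x∉xs un (there p∈))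
...   | no _ | yes refl = ⊥-elim (Unique[x∷xs]⇒x∉xs un′ p∈)
...   | no _ | no _ = there (there p∈) , inv , free
partner-involution (x ∷ []) _ ()

-- Edge sets as Boolean vectors

vec-ext : ∀ {m} {u v : Vec Bool m} → (∀ i → lookup u i ≡ lookup v i) → u ≡ v
vec-ext {u = []}    {[]}    p = refl
vec-ext {u = _ ∷ _} {_ ∷ _} p = cong₂ _∷_ (p zero) (vec-ext (p ∘ suc))

∈⇒true : ∀ {m} {S : Subset m} {e} → e ∈ˢ S → lookup S e ≡ true
∈⇒true = []=⇒lookup

true⇒∈ : ∀ {m} {S : Subset m} {e} → lookup S e ≡ true → e ∈ˢ S
true⇒∈ {S = S} {e} = lookup⇒[]= e S

infixl 7 _∖_ _∪₁_

_∖_ _∪₁_ : ∀ {m} → Subset m → Fin m → Subset m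
S ∖ g = S [ g ]≔ false
S ∪₁ g = S [ g ]≔ true

∈-∖⁻ : ∀ {m} {S : Subset m} {g e} → e ∈ˢ (S ∖ g) → e ∈ˢ S × e ≢ g
∈-∖⁻ {S = S} {g} {e} p with e ≟ g
... | yes refl with () ← trans (sym (∈⇒true p)) (lookup∘update g S false)
... | no e≢g = true⇒∈ (trans (sym (lookup∘update′ e≢g S false)) (∈⇒true p)) , e≢g

∈-∖⁺ : ∀ {m} {S : Subset m} {g e} → e ∈ˢ S → e ≢ g → e ∈ˢ (S ∖ g)
∈-∖⁺ {S = S} p e≢g = true⇒∈ (trans (lookup∘update′ e≢g S false) (∈⇒true p))

∈-∪₁⁻ : ∀ {m} {S : Subset m} {g e} → e ∈ˢ (S ∪₁ g) → e ≡ g ⊎ e ∈ˢ S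
∈-∪₁⁻ {S = S} {g} {e} p with e ≟ g
... | yes e≡g = inj₁ e≡g
... | no e≢g = inj₂ (true⇒∈ (trans (sym (lookup∘update′ e≢g S true)) (∈⇒true p)))

∈-∪₁-new : ∀ {m} {S : Subset m} g → g ∈ˢ (S ∪₁ g)
∈-∪₁-new {S = S} g = true⇒∈ (lookup∘update g S true)

∈-∪₁-old : ∀ {m} {S : Subset m} {g e} → e ∈ˢ S → e ∈ˢ (S ∪₁ g)
∈-∪₁-old {S = S} {g} {e} p with e ≟ g
... | yes refl = ∈-∪₁-new g
... | no e≢g = true⇒∈ (trans (lookup∘update′ e≢g S true) (∈⇒true p))

∈ˢ? : ∀ {m} (S : Subset m) e → Dec (e ∈ˢ S)
∈ˢ? S e = Dec-map true⇒∈ ∈⇒true (lookup S e ≟ᵇ true)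

-- Reachability

module Walks (G : Graph) where
  open Graph G

  tail head : Edge G → Vertex G
  tail e = proj₁ (ends e)
  head e = proj₂ (ends e)

  δ : (Vertex G → Bool) → Edge G → Bool
  δ χ e = χ (tail e) xor χ (head e)

  Link-sym : ∀ {e x y} → Link G e x y → Link G e y x
  Link-sym (inj₁ p) = inj₂ p
  Link-sym (inj₂ p) = inj₁ p

  Reach-map : ∀ {S S′ : Edge G → Set} → (∀ e → S e → S′ e) → ∀ {x y} → Reach G S x y → Reach G S′ x y
  Reach-map f here = here
  Reach-map f (step e s l p) = step e (f e s) l (Reach-map f p)

  Reach-trans : ∀ {S x y z} → Reach G S x y → Reach G S y z → Reach G S x z
  Reach-trans here q = q
  Reach-trans (step e s l p) q = step e s l (Reach-trans p q)

  Reach-sym : ∀ {S x y} → Reach G S x y → Reach G S y x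
  Reach-sym here = here
  Reach-sym (step e s l p) = Reach-trans (Reach-sym p) (step e s (Link-sym l) here)

  Reach-edge : ∀ {S : Edge G → Set} {e} → S e → Reach G S (tail e) (head e)
  Reach-edge s = step _ s (inj₁ (refl , refl)) here

  Reach-invariant : ∀ {S} (χ : Vertex G → Bool) → (∀ e → S e → δ χ e ≡ false) →
                    ∀ {x y} → Reach G S x y → χ x ≡ χ y
  Reach-invariant χ c here = refl
  Reach-invariant χ c (step e s l p) = trans (across l) (Reach-invariant χ c p)
    where
    across : ∀ {x y} → Link G e x y → χ x ≡ χ y
    across (inj₁ (refl , refl)) = xor-false (c e s)
    across (inj₂ (refl , refl)) = sym (xor-false (c e s))

  -- One crossing of `g` suffices: when a walk starts by crossing `g` and its remainder crosses
  -- again, the part between the crossings is discarded, and two crossings in opposite directions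
  -- cancel.
  Reach-split : ∀ {S S′ : Edge G → Set} g → (∀ e → S e → e ≡ g ⊎ S′ e) → ∀ {x z} → Reach G S x z →
    Reach G S′ x z ⊎ (Reach G S′ x (tail g) × Reach G S′ (head g) z)
                   ⊎ (Reach G S′ x (head g) × Reach G S′ (tail g) z)
  Reach-split g f here = inj₁ here
  Reach-split g f (step e s l p) with f e s | Reach-split g f p
  ... | inj₂ s′ | inj₁ q = inj₁ (step e s′ l q)
  ... | inj₂ s′ | inj₂ (inj₁ (q , q′)) = inj₂ (inj₁ (step e s′ l q , q′))
  ... | inj₂ s′ | inj₂ (inj₂ (q , q′)) = inj₂ (inj₂ (step e s′ l q , q′))
  Reach-split g f (step e s (inj₁ (refl , refl)) p) | inj₁ refl | inj₁ q = inj₂ (inj₁ (here , q))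
  Reach-split g f (step e s (inj₁ (refl , refl)) p) | inj₁ refl | inj₂ (inj₁ (_ , q)) = inj₂ (inj₁ (here , q))
  Reach-split g f (step e s (inj₁ (refl , refl)) p) | inj₁ refl | inj₂ (inj₂ (_ , q)) = inj₁ q
  Reach-split g f (step e s (inj₂ (refl , refl)) p) | inj₁ refl | inj₁ q = inj₂ (inj₂ (here , q))
  Reach-split g f (step e s (inj₂ (refl , refl)) p) | inj₁ refl | inj₂ (inj₁ (_ , q)) = inj₁ q
  Reach-split g f (step e s (inj₂ (refl , refl)) p) | inj₁ refl | inj₂ (inj₂ (_ , q)) = inj₂ (inj₂ (here , q))

  -- Induction on the list of edges that may be used. By `Reach-split`, allowing one more edge `g`
  -- reduces to five reachability questions without `g`.
  reach? : ∀ {S : Edge G → Set} → (∀ e → Dec (S e)) → ∀ x y → Dec (Reach G S x y)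
  reach? {S} S? x y = Dec-map (Reach-map λ _ → proj₁) (Reach-map λ e s → s , ∈-allFin e) (within (allFin m) x y)
    where
    Within : List (Edge G) → Edge G → Set
    Within es e = S e × e ∈ₗ es
    within : ∀ es x y → Dec (Reach G (Within es) x y)
    within [] x y = Dec-map (λ { refl → here }) (λ { here → refl ; (step _ (_ , ()) _ _) }) (x ≟ y)
    within (g ∷ es) x y with S? g
    ... | no ¬s = Dec-map (Reach-map λ _ (s , i) → s , there i)
                    (Reach-map λ { _ (s , here refl) → ⊥-elim (¬s s) ; _ (s , there i) → s , i }) (within es x y)
    ... | yes s = Dec-map [ weaken , [ (λ (p , q) → Reach-trans (weaken p) (Reach-trans edge (weaken q)))
                                     , (λ (p , q) → Reach-trans (weaken p) (Reach-trans (Reach-sym edge) (weaken q))) ]′ ]′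
                    (Reach-split g λ { _ (s , here e≡g) → inj₁ e≡g ; _ (s , there i) → inj₂ (s , i) })
                    (within es x y ⊎-dec (within es x (tail g) ×-dec within es (head g) y)
                                   ⊎-dec (within es x (head g) ×-dec within es (tail g) y))
      where
      weaken : ∀ {x y} → Reach G (Within es) x y → Reach G (Within (g ∷ es)) x y
      weaken = Reach-map λ _ (s , i) → s , there i
      edge : Reach G (Within (g ∷ es)) (tail g) (head g)
      edge = Reach-edge (s , here refl)

  acyclic? : ∀ {S : Edge G → Set} → (∀ e → Dec (S e)) → Dec (Acyclic G S)
  acyclic? S? = all? λ e → S? e →-dec ¬? (reach? (λ f → S? f ×-dec ¬? (f ≟ e)) (tail e) (head e))

-- Trees and their fundamental cuts

module Cuts (G : Graph) (v w r : Vertex G) (r∈R : Deleted.VR G v w r) where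
  open Graph G
  open Deleted G v w
  open Walks G

  Tree : Subset m → Set
  Tree S = SpanningTree (_∈ˢ S)

  VR? : ∀ x → Dec (VR x)
  VR? x = ¬? (x ≟ v) ×-dec ¬? (x ≟ w)

  ER? : ∀ e → Dec (ER e)
  ER? e = VR? (tail e) ×-dec VR? (head e)

  tree? : ∀ S → Dec (Tree S)
  tree? S = all? (λ e → ∈ˢ? S e →-dec ER? e)
      ×-dec all? (λ x → all? λ y → VR? x →-dec (VR? y →-dec reach? (∈ˢ? S) x y))
      ×-dec acyclic? (∈ˢ? S)

  abstract
    -- The value `false` on the side of the root is a normalisation: functions vanishing at `r` are
    -- determined by their changes along a spanning tree, as in `unique`.
    κ : Subset m → Vertex G → Bool
    κ S x = not (does (reach? (∈ˢ? S) x r))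

    κ-false : ∀ {S x} → κ S x ≡ false → Reach G (_∈ˢ S) x r
    κ-false {S} {x} p = does⇒ (reach? (∈ˢ? S) x r) (trans (sym (not-involutive _)) (cong not p))

    κ-Reach : ∀ {S x y} → Reach G (_∈ˢ S) x y → κ S x ≡ κ S y
    κ-Reach {S} {x} {y} p =
      cong not (does-⇔ (reach? (∈ˢ? S) x r) (reach? (∈ˢ? S) y r) (Reach-trans (Reach-sym p)) (Reach-trans p))

    κ-root : ∀ S → κ S r ≡ false
    κ-root S = cong not (dec-true (reach? (∈ˢ? S) r r) here)

  κ-const : ∀ {S e} → e ∈ˢ S → δ (κ S) e ≡ false
  κ-const {S} {e} e∈S rewrite κ-Reach (Reach-edge {_∈ˢ S} e∈S) = xor-same (κ S (head e))

  -- A forest on R with at most one component besides that of r.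
  record Bicolored (F : Subset m) : Set where
    field
      within  : ∀ e → e ∈ˢ F → ER e
      acyclic : Acyclic G (_∈ˢ F)
      class   : ∀ {x y} → VR x → VR y → κ F x ≡ κ F y → Reach G (_∈ˢ F) x y
  open Bicolored

  acyclic-∖ : ∀ {S g} → Acyclic G (_∈ˢ S) → Acyclic G (_∈ˢ (S ∖ g))
  acyclic-∖ ac e e∈ p = ac e (proj₁ (∈-∖⁻ e∈)) (Reach-map (λ _ (f∈ , f≢) → proj₁ (∈-∖⁻ f∈) , f≢) p)

  ∉-∪₁ : ∀ {S : Subset m} {g} e → e ∈ˢ S → e ≡ g ⊎ e ∈ˢ (S ∖ g)
  ∉-∪₁ {g = g} e e∈ with e ≟ g
  ... | yes p = inj₁ p
  ... | no p = inj₂ (∈-∖⁺ e∈ p)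

  -- The walk to the root in the tree must cross `g`, and its part before the crossing survives the
  -- removal of `g`.
  cut-class : ∀ {S g} → Tree S → ∀ {x} → VR x → κ (S ∖ g) x ≡ true →
    Reach G (_∈ˢ (S ∖ g)) x (tail g) ⊎ Reach G (_∈ˢ (S ∖ g)) x (head g)
  cut-class {S} {g} (_ , con , _) x∈R κx with Reach-split g ∉-∪₁ (con _ r x∈R r∈R)
  ... | inj₁ p with () ← trans (sym κx) (trans (κ-Reach p) (κ-root (S ∖ g)))
  ... | inj₂ (inj₁ (p , _)) = inj₁ p
  ... | inj₂ (inj₂ (p , _)) = inj₂ p

  cut-sep : ∀ {S g} → Tree S → g ∈ˢ S → ¬ Reach G (_∈ˢ (S ∖ g)) (tail g) (head g)
  cut-sep (_ , _ , ac) g∈ p = ac _ g∈ (Reach-map (λ _ → ∈-∖⁻) p)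

  -- If both ends of `g` were joined to the root without `g`, there would be a cycle. If neither
  -- were, the tree walk from `tail g` to the root would still have to end on a piece that starts at
  -- an end of `g` and avoids `g`, or close a cycle.
  cut : ∀ {S g} → Tree S → g ∈ˢ S → δ (κ (S ∖ g)) g ≡ true
  cut {S} {g} tr@(sub , con , _) g∈ = xor-true λ eq → differ eq
    where
    t∈R = proj₁ (sub g g∈)
    h∈R = proj₂ (sub g g∈)
    differ : κ (S ∖ g) (tail g) ≢ κ (S ∖ g) (head g)
    differ eq with κ (S ∖ g) (tail g) in κt
    ... | false = cut-sep tr g∈ (Reach-trans (κ-false κt) (Reach-sym (κ-false (sym eq))))
    ... | true with Reach-split g ∉-∪₁ (con (tail g) r t∈R r∈R)
    ...   | inj₁ p with () ← trans (sym κt) (trans (κ-Reach p) (κ-root (S ∖ g)))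
    ...   | inj₂ (inj₁ (_ , p)) with () ← trans eq (trans (κ-Reach p) (κ-root (S ∖ g)))
    ...   | inj₂ (inj₂ (p , _)) = cut-sep tr g∈ p

  -- Two vertices away from the root reach ends of `g` by `cut-class`; if these were different ends,
  -- both ends would be away from the root, against `cut`.
  Tree⇒Bicolored : ∀ {S g} → Tree S → g ∈ˢ S → Bicolored (S ∖ g)
  Tree⇒Bicolored tr@(sub , _ , ac) g∈ .within e e∈ = sub e (proj₁ (∈-∖⁻ e∈))
  Tree⇒Bicolored tr@(sub , _ , ac) g∈ .acyclic = acyclic-∖ ac
  Tree⇒Bicolored {S} {g} tr g∈ .class {x} {y} x∈R y∈R eq with κ (S ∖ g) x in κx
  ... | false = Reach-trans (κ-false κx) (Reach-sym (κ-false (sym eq)))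
  ... | true with cut-class tr x∈R κx | cut-class tr y∈R (sym eq)
  ...   | inj₁ p | inj₁ q = Reach-trans p (Reach-sym q)
  ...   | inj₂ p | inj₂ q = Reach-trans p (Reach-sym q)
  ...   | inj₁ p | inj₂ q = ⊥-elim (false≢true (trans (sym (xor-same true)) (trans
            (cong₂ _xor_ (trans (sym κx) (κ-Reach p)) (trans eq (κ-Reach q))) (cut tr g∈))))
  ...   | inj₂ p | inj₁ q = ⊥-elim (false≢true (trans (sym (xor-same true)) (trans
            (cong₂ _xor_ (trans eq (κ-Reach q)) (trans (sym κx) (κ-Reach p))) (cut tr g∈))))

  δ-xor : ∀ (χ ω : Vertex G → Bool) e → δ (λ x → χ x xor ω x) e ≡ δ χ e xor δ ω e
  δ-xor χ ω e = xor-interchange (χ (tail e)) _ _ _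

  δ-scale : ∀ c (χ : Vertex G → Bool) e → δ (λ x → c ∧ χ x) e ≡ c ∧ δ χ e
  δ-scale false χ e = refl
  δ-scale true χ e = refl

  -- The new edge joins the two classes. It closes no cycle because `κ F` is constant on walks in
  -- `F` and changes across `e`; for an edge `g` of `F`, a function constant on all edges except `g`
  -- excludes a cycle through `g`.
  Bicolored⇒Tree : ∀ {F e} → Bicolored F → ER e → δ (κ F) e ≡ true → Tree (F ∪₁ e)
  Bicolored⇒Tree {F} {e} bi e∈R δe = sub , con , ac
    where
    sub : ∀ g → g ∈ˢ (F ∪₁ e) → ER g
    sub g g∈ with ∈-∪₁⁻ g∈
    ... | inj₁ refl = e∈R
    ... | inj₂ g∈F = bi .within g g∈F

    lift : ∀ {x y} → Reach G (_∈ˢ F) x y → Reach G (_∈ˢ (F ∪₁ e)) x y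
    lift = Reach-map λ _ → ∈-∪₁-old
    edge = Reach-edge {_∈ˢ (F ∪₁ e)} (∈-∪₁-new e)

    -- Each of the two pairs of distinct Booleans exhausts the two classes, so the ends of `e` match
    -- `x` and `y` in one of two orders.
    three : ∀ {x y t h : Bool} → t xor h ≡ true → x ≢ y → (x ≡ t × h ≡ y) ⊎ (x ≡ h × t ≡ y)
    three {false} {false} p q = ⊥-elim (q refl)
    three {true} {true} p q = ⊥-elim (q refl)
    three {false} {true} {false} {true} p q = inj₁ (refl , refl)
    three {false} {true} {true} {false} p q = inj₂ (refl , refl)
    three {true} {false} {true} {false} p q = inj₁ (refl , refl)
    three {true} {false} {false} {true} p q = inj₂ (refl , refl)

    con : ∀ x y → VR x → VR y → Reach G (_∈ˢ (F ∪₁ e)) x y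
    con x y x∈R y∈R with κ F x ≟ᵇ κ F y
    ... | yes eq = lift (bi .class x∈R y∈R eq)
    ... | no ne with three δe ne
    ...   | inj₁ (p , q) = Reach-trans (lift (bi .class x∈R (proj₁ e∈R) p))
                             (Reach-trans edge (lift (bi .class (proj₂ e∈R) y∈R q)))
    ...   | inj₂ (p , q) = Reach-trans (lift (bi .class x∈R (proj₂ e∈R) p))
                             (Reach-trans (Reach-sym edge) (lift (bi .class (proj₁ e∈R) y∈R q)))

    ac : Acyclic G (_∈ˢ (F ∪₁ e))
    ac g g∈ p with g ≟ e
    ... | yes refl = false≢true (trans (sym (trans (cong (_xor κ F (head e)) (κ-Reach q)) (xor-same (κ F (head e))))) δe)
      where
      restrict : ∀ f → f ∈ˢ (F ∪₁ e) × f ≢ e → f ∈ˢ F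
      restrict f (f∈ , f≢) = [ ⊥-elim ∘ f≢ , (λ z → z) ]′ (∈-∪₁⁻ f∈)
      q = Reach-map restrict p
    ... | no g≢e with ∈-∪₁⁻ g∈
    ...   | inj₁ g≡e = g≢e g≡e
    ...   | inj₂ g∈F = false≢true (trans (sym (trans (cong (_xor ω (head g)) (Reach-invariant ω ω-const p))
                                                     (xor-same (ω (head g))))) ω-g)
      where
      side? : ∀ x → Dec (Reach G (λ f → f ∈ˢ F × f ≢ g) x (tail g))
      side? x = reach? (λ f → ∈ˢ? F f ×-dec ¬? (f ≟ g)) x (tail g)
      χ : Vertex G → Bool
      χ x = does (side? x)
      χ-const : ∀ f → f ∈ˢ F → f ≢ g → δ χ f ≡ false
      χ-const f f∈ f≢ = trans (cong (_xor χ (head f)) (does-⇔ (side? (tail f)) (side? (head f))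
        (Reach-trans (Reach-sym fe)) (Reach-trans fe))) (xor-same (χ (head f)))
        where fe = Reach-edge {λ f → f ∈ˢ F × f ≢ g} (f∈ , f≢)
      χ-g : δ χ g ≡ true
      χ-g = cong₂ _xor_ (dec-true (side? (tail g)) here)
                        (dec-false (side? (head g)) (bi .acyclic g g∈F ∘ Reach-sym))
      -- `χ` is the indicator of the part of `F` without `g` that contains `tail g`. It may change
      -- across `e`; adding `κ F` then repairs this without affecting any edge of `F`.
      ω : Vertex G → Bool
      ω x = χ x xor (δ χ e ∧ κ F x)
      δω : ∀ f → δ ω f ≡ δ χ f xor (δ χ e ∧ δ (κ F) f)
      δω f = trans (δ-xor χ (λ x → δ χ e ∧ κ F x) f) (cong (δ χ f xor_) (δ-scale (δ χ e) (κ F) f))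
      ω-g : δ ω g ≡ true
      ω-g = trans (δω g) (cong₂ _xor_ χ-g (trans (cong (δ χ e ∧_) (κ-const g∈F)) (∧-zeroʳ (δ χ e))))
      ω-const : ∀ f → f ∈ˢ (F ∪₁ e) × f ≢ g → δ ω f ≡ false
      ω-const f (f∈ , f≢) with ∈-∪₁⁻ f∈
      ... | inj₁ refl = trans (δω e) (trans (cong (λ z → δ χ e xor (δ χ e ∧ z)) δe)
                          (trans (cong (δ χ e xor_) (∧-identityʳ (δ χ e))) (xor-same (δ χ e))))
      ... | inj₂ f∈F = trans (δω f) (cong₂ _xor_ (χ-const f f∈F f≢)
                          (trans (cong (δ χ e ∧_) (κ-const f∈F)) (∧-zeroʳ (δ χ e))))

  exchange : ∀ {S g e} → Tree S → g ∈ˢ S → ER e → δ (κ (S ∖ g)) e ≡ true → Tree (S ∖ g ∪₁ e)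
  exchange tr g∈ = Bicolored⇒Tree (Tree⇒Bicolored tr g∈)

  ∖-∪₁ : ∀ {F : Subset m} {e} → e ∉ˢ F → (F ∪₁ e) ∖ e ≡ F
  ∖-∪₁ {F} {e} e∉ = vec-ext λ i → at i
    where
    at : ∀ i → lookup ((F ∪₁ e) ∖ e) i ≡ lookup F i
    at i with i ≟ e
    ... | no i≢e = trans (lookup∘update′ i≢e (F ∪₁ e) false) (lookup∘update′ i≢e F true)
    ... | yes refl with lookup F e in eq
    ...   | true = ⊥-elim (e∉ (true⇒∈ eq))
    ...   | false = lookup∘update e (F ∪₁ e) false

  -- Both sides vanish at the root and change equally across every `e` in `S`, since among the
  -- functions `κ (S ∖ g)` only the one with `g = e` changes there. Equality spreads along the tree
  -- walk from the root.
  expand : ∀ {S} → Tree S → (χ : Vertex G → Bool) → ∀ {x} → VR x →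
    χ x xor χ r ≡ sum (λ g → lookup S g ∧ (δ χ g ∧ κ (S ∖ g) x))
  expand {S} tr@(_ , con , _) χ {x} x∈R = walk (con x r x∈R r∈R)
    where
    open ≡-Reasoning
    rhs : Vertex G → Bool
    rhs x = sum λ g → lookup S g ∧ (δ χ g ∧ κ (S ∖ g) x)
    along : ∀ {e} → e ∈ˢ S → rhs (tail e) xor rhs (head e) ≡ δ χ e
    along {e} e∈ = begin
      rhs (tail e) xor rhs (head e) ≡⟨ ∑-distrib-+ (λ g → lookup S g ∧ (δ χ g ∧ κ (S ∖ g) (tail e))) _ ⟨
      sum (λ g → (lookup S g ∧ (δ χ g ∧ κ (S ∖ g) (tail e))) xor (lookup S g ∧ (δ χ g ∧ κ (S ∖ g) (head e))))
        ≡⟨ sum-cong-≗ (λ g → ∧-xor² (lookup S g) (δ χ g) _ _) ⟩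
      sum (λ g → lookup S g ∧ (δ χ g ∧ δ (κ (S ∖ g)) e))
        ≡⟨ sum-single e _ (λ g g≢e → trans (cong (λ z → lookup S g ∧ (δ χ g ∧ z)) (κ-const (∈-∖⁺ e∈ (g≢e ∘ sym))))
             (trans (cong (lookup S g ∧_) (∧-zeroʳ (δ χ g))) (∧-zeroʳ (lookup S g)))) ⟩
      lookup S e ∧ (δ χ e ∧ δ (κ (S ∖ e)) e) ≡⟨ cong₂ (λ a b → a ∧ (δ χ e ∧ b)) (∈⇒true e∈) (cut tr e∈) ⟩
      δ χ e ∧ true ≡⟨ ∧-identityʳ (δ χ e) ⟩
      δ χ e ∎
    move : ∀ a b c d z → c xor d ≡ a xor b → b xor z ≡ d → a xor z ≡ c
    move a b c d z p refl = begin
      a xor z ≡⟨ xor-cancelʳ a z b ⟨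
      (a xor b) xor (z xor b) ≡⟨ cong₂ _xor_ (sym p) (xor-comm z b) ⟩
      (c xor (b xor z)) xor (b xor z) ≡⟨ xor-assoc c _ _ ⟩
      c xor ((b xor z) xor (b xor z)) ≡⟨ cong (c xor_) (xor-same (b xor z)) ⟩
      c xor false ≡⟨ xor-identityʳ c ⟩
      c ∎
    walk : ∀ {x} → Reach G (_∈ˢ S) x r → χ x xor χ r ≡ rhs x
    walk here = trans (xor-same (χ r)) (sym (sum-false λ g →
      trans (cong (λ z → lookup S g ∧ (δ χ g ∧ z)) (κ-root (S ∖ g)))
        (trans (cong (lookup S g ∧_) (∧-zeroʳ (δ χ g))) (∧-zeroʳ (lookup S g)))))
    walk (step e e∈ (inj₁ (refl , refl)) p) = move (χ (tail e)) (χ (head e)) _ _ (χ r) (along e∈) (walk p)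
    walk (step e e∈ (inj₂ (refl , refl)) p) =
      move (χ (head e)) (χ (tail e)) _ _ (χ r) (trans (xor-comm (rhs (head e)) _) (trans (along e∈) (xor-comm (χ (tail e)) _))) (walk p)

  -- The root values of the two ends cancel. As `δ (κ (S ∖ g)) e` tells whether `g` lies on the path
  -- of `S` between the ends of `e`, this adds up the changes of `χ` along that path.
  expand-δ : ∀ {S} → Tree S → (χ : Vertex G → Bool) → ∀ {e} → ER e →
    δ χ e ≡ sum (λ g → lookup S g ∧ (δ χ g ∧ δ (κ (S ∖ g)) e))
  expand-δ {S} tr χ {e} (t∈R , h∈R) = begin
    χ (tail e) xor χ (head e) ≡⟨ xor-cancelʳ (χ (tail e)) (χ (head e)) (χ r) ⟨
    (χ (tail e) xor χ r) xor (χ (head e) xor χ r) ≡⟨ cong₂ _xor_ (expand tr χ t∈R) (expand tr χ h∈R) ⟩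
    _ ≡⟨ ∑-distrib-+ (λ g → lookup S g ∧ (δ χ g ∧ κ (S ∖ g) (tail e))) _ ⟨
    _ ≡⟨ sum-cong-≗ (λ g → ∧-xor² (lookup S g) (δ χ g) _ _) ⟩
    sum (λ g → lookup S g ∧ (δ χ g ∧ δ (κ (S ∖ g)) e)) ∎
    where
    open ≡-Reasoning

  -- The sum of the two functions is constant along the tree and zero at the root. Below it
  -- identifies cuts of different trees by comparing them edge by edge.
  unique : ∀ {S} → Tree S → (χ ω : Vertex G → Bool) → χ r ≡ ω r → (∀ e → e ∈ˢ S → δ χ e ≡ δ ω e) →
           ∀ {x} → VR x → χ x ≡ ω x
  unique (_ , con , _) χ ω root eq {x} x∈R = xor-false (trans
    (Reach-invariant (λ x → χ x xor ω x)
      (λ e e∈ → trans (δ-xor χ ω e) (trans (cong (_xor δ ω e) (eq e e∈)) (xor-same (δ ω e)))) (con x r x∈R r∈R))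
    (trans (cong (_xor ω r) root) (xor-same (ω r))))

-- The least true index, provided that `b d` is true; `d` bounds the search and is the default.
find : ∀ {n} → (Fin n → Bool) → Fin n → Fin n
find {suc n} b d with b zero | d
... | true  | _     = zero
... | false | zero  = zero
... | false | suc d = suc (find (b ∘ suc) d)

find-true : ∀ {n} (b : Fin n → Bool) d → b d ≡ true → b (find b d) ≡ true
find-true {suc n} b d p with b zero in eq | d
... | true  | _     = eq
... | false | zero  with () ← trans (sym eq) p
... | false | suc d = find-true (b ∘ suc) d p

-- The least true index does not depend on the true index that bounds the search.
find-cong : ∀ {n} (b b′ : Fin n → Bool) d d′ → b d ≡ true → b′ d′ ≡ true → (∀ i → b i ≡ b′ i) →
            find b d ≡ find b′ d′
find-cong {suc n} b b′ d d′ p p′ eq with b zero in z | b′ zero in z′ | d | d′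
... | true  | true  | _     | _     = refl
... | true  | false | _     | _     with () ← trans (sym z) (trans (eq zero) z′)
... | false | true  | _     | _     with () ← trans (sym z) (trans (eq zero) z′)
... | false | false | zero  | _     with () ← trans (sym z) p
... | false | false | suc _ | zero  with () ← trans (sym z′) p′
... | false | false | suc d | suc d′ = cong suc (find-cong (b ∘ suc) (b′ ∘ suc) d d′ p p′ (eq ∘ suc))

-- Symmetric differences and exchanges as translations

lookup-⊕ : ∀ {m} (u v : Vec Bool m) i → lookup (u ⊕ v) i ≡ lookup u i xor lookup v i
lookup-⊕ u v i = lookup-zipWith _xor_ i u v

⊕-self : ∀ {m} (u v : Vec Bool m) → u ⊕ v ⊕ v ≡ u
⊕-self u v = vec-ext λ i → begin
  lookup (u ⊕ v ⊕ v) i ≡⟨ lookup-⊕ (u ⊕ v) v i ⟩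
  lookup (u ⊕ v) i xor lookup v i ≡⟨ cong (_xor lookup v i) (lookup-⊕ u v i) ⟩
  (lookup u i xor lookup v i) xor lookup v i ≡⟨ xor-assoc (lookup u i) _ _ ⟩
  lookup u i xor (lookup v i xor lookup v i) ≡⟨ cong (lookup u i xor_) (xor-same (lookup v i)) ⟩
  lookup u i xor false ≡⟨ xor-identityʳ _ ⟩
  lookup u i ∎
  where open ≡-Reasoning

⊕-swap : ∀ {m} (u v v′ : Vec Bool m) → u ⊕ v ⊕ v′ ≡ u ⊕ v′ ⊕ v
⊕-swap u v v′ = vec-ext λ i → begin
  lookup (u ⊕ v ⊕ v′) i ≡⟨ trans (lookup-⊕ (u ⊕ v) v′ i) (cong (_xor lookup v′ i) (lookup-⊕ u v i)) ⟩
  (lookup u i xor lookup v i) xor lookup v′ i ≡⟨ xor-assoc (lookup u i) _ _ ⟩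
  lookup u i xor (lookup v i xor lookup v′ i) ≡⟨ cong (lookup u i xor_) (xor-comm (lookup v i) _) ⟩
  lookup u i xor (lookup v′ i xor lookup v i) ≡⟨ xor-assoc (lookup u i) _ _ ⟨
  (lookup u i xor lookup v′ i) xor lookup v i ≡⟨ trans (lookup-⊕ (u ⊕ v′) v i) (cong (_xor lookup v i) (lookup-⊕ u v′ i)) ⟨
  lookup (u ⊕ v′ ⊕ v) i ∎
  where open ≡-Reasoning

∉⇒false : ∀ {m} {S : Subset m} {e} → e ∉ˢ S → lookup S e ≡ false
∉⇒false {S = S} {e} e∉ with lookup S e in eq
... | true  = ⊥-elim (e∉ (true⇒∈ eq))
... | false = refl

false⇒∉ : ∀ {m} {S : Subset m} {e} → lookup S e ≡ false → e ∉ˢ S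
false⇒∉ p e∈ = false≢true (trans (sym p) (∈⇒true e∈))

lookup-∖ : ∀ {m} (S : Subset m) g i → lookup (S ∖ g) i ≡ lookup S i ∧ not (i == g)
lookup-∖ S g i with i ≟ g
... | yes refl = trans (lookup∘update g S false) (sym (∧-zeroʳ _))
... | no i≢g = trans (lookup∘update′ i≢g S false) (sym (∧-identityʳ _))

lookup-∪₁ : ∀ {m} (S : Subset m) g i → lookup (S ∪₁ g) i ≡ lookup S i ∨ (i == g)
lookup-∪₁ S g i with i ≟ g
... | yes refl = trans (lookup∘update g S true) (sym (∨-zeroʳ _))
... | no i≢g = trans (lookup∘update′ i≢g S true) (sym (∨-identityʳ _))

pair : ∀ {m} → Fin m → Fin m → Vec Bool m
pair e g = tabulate λ i → (i == e) xor (i == g)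

pair-comm : ∀ {m} (e g : Fin m) → pair e g ≡ pair g e
pair-comm e g = vec-ext λ i → trans (lookup∘tabulate _ i) (trans (xor-comm (i == e) _) (sym (lookup∘tabulate _ i)))

-- An exchange of two edges becomes a translation of the cube, to which `Σᵥ-shift` applies.
⊕-pair : ∀ {m} {S : Subset m} {e g} → e ∈ˢ S → g ∉ˢ S → S ⊕ pair e g ≡ S ∖ e ∪₁ g
⊕-pair {S = S} {e} {g} e∈ g∉ = vec-ext λ i →
  trans (trans (lookup-⊕ S _ i) (cong (lookup S i xor_) (lookup∘tabulate _ i)))
    (trans (at i) (sym (trans (lookup-∪₁ (S ∖ e) g i) (cong (_∨ (i == g)) (lookup-∖ S e i)))))
  where
  at : ∀ i → lookup S i xor ((i == e) xor (i == g)) ≡ (lookup S i ∧ not (i == e)) ∨ (i == g)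
  at i with i ≟ e | i ≟ g
  ... | yes refl | yes refl = ⊥-elim (g∉ e∈)
  ... | yes refl | no _ rewrite ∈⇒true e∈ = refl
  ... | no _ | yes refl rewrite ∉⇒false g∉ = refl
  ... | no _ | no _ with lookup S i
  ...   | true = refl
  ...   | false = refl

-- States and the exchange along a crossing edge

module States (G : Graph) (v w r b c : Vertex G)
  (r∈R : Deleted.VR G v w r) (b∈R : Deleted.VR G v w b) (c∈R : Deleted.VR G v w c)
  (r≢b : r ≢ b) (r≢c : r ≢ c) (b≢c : b ≢ c) where
  open Graph G
  open Deleted G v w
  open Walks G
  open Cuts G v w r r∈R

  sum-congₑ : ∀ {f g : Edge G → Bool} → (∀ e → f e ≡ g e) → sum f ≡ sum g
  sum-congₑ = sum-cong-≗ {m}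

  sum-falseₑ : ∀ {f : Edge G → Bool} → (∀ e → f e ≡ false) → sum f ≡ false
  sum-falseₑ = sum-false {m}

  Σᵥ-congₑ : ∀ {F H : Subset m → Bool} → (∀ ψ → F ψ ≡ H ψ) → Σᵥ F ≡ Σᵥ H
  Σᵥ-congₑ = Σᵥ-cong {m}

  er : Edge G → Bool
  er e = does (ER? e)

  comp : Subset m → Subset m
  comp ψ = tabulate λ e → er e ∧ not (lookup ψ e)

  -- Adding this vector complements a set within E(R) except at `f`, which makes the exchange along
  -- `f` a translation.
  mask : Edge G → Subset m
  mask f = tabulate λ e → er e ∧ not (e == f)

  -- For f ∈ ψ ⊆ E(R) this is (E(R) ∖ ψ) ∪ {f}.
  σ : Edge G → Subset m → Subset m
  σ f ψ = ψ ⊕ mask f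

  σ-σ : ∀ f ψ → σ f (σ f ψ) ≡ ψ
  σ-σ f ψ = ⊕-self ψ (mask f)

  ∈-comp : ∀ {ψ e} → e ∈ˢ comp ψ → ER e × e ∉ˢ ψ
  ∈-comp {ψ} {e} p with ∧-true (trans (sym (lookup∘tabulate _ e)) (∈⇒true p))
  ... | q , q′ = does⇒ (ER? e) q , false⇒∉ (not-injective q′)

  comp-∈ : ∀ {ψ e} → ER e → e ∉ˢ ψ → e ∈ˢ comp ψ
  comp-∈ {ψ} {e} p q = true⇒∈ (trans (lookup∘tabulate _ e) (∧-intro (dec-true (ER? e) p) (cong not (∉⇒false q))))

  module _ {ψ : Subset m} {f : Edge G} (tr : Tree ψ) (f∈ : f ∈ˢ ψ) where
    lookup-σ : ∀ i → lookup (σ f ψ) i ≡ lookup ψ i xor (er i ∧ not (i == f))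
    lookup-σ i = trans (lookup-⊕ ψ (mask f) i) (cong (lookup ψ i xor_) (lookup∘tabulate _ i))

    er-true : ∀ {i} → lookup ψ i ≡ true → er i ≡ true
    er-true {i} p = dec-true (ER? i) (proj₁ tr i (true⇒∈ p))

    σ≡ : σ f ψ ≡ comp ψ ∪₁ f
    σ≡ = vec-ext λ i → trans (lookup-σ i) (trans (at i)
           (sym (trans (lookup-∪₁ (comp ψ) f i) (cong (_∨ (i == f)) (lookup∘tabulate _ i)))))
      where
      at : ∀ i → lookup ψ i xor (er i ∧ not (i == f)) ≡ (er i ∧ not (lookup ψ i)) ∨ (i == f)
      at i with i ≟ f
      ... | yes refl rewrite ∈⇒true f∈ | er-true (∈⇒true f∈) = refl
      ... | no _ with lookup ψ i in eq
      ...   | true rewrite er-true eq = refl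
      ...   | false with er i
      ...     | true = refl
      ...     | false = refl

    f∉comp : f ∉ˢ comp ψ
    f∉comp p = proj₂ (∈-comp p) f∈

    σ∖ : σ f ψ ∖ f ≡ comp ψ
    σ∖ = trans (cong (_∖ f) σ≡) (∖-∪₁ f∉comp)

    f∈σ : f ∈ˢ σ f ψ
    f∈σ = subst (f ∈ˢ_) (sym σ≡) (∈-∪₁-new f)

    ∈-σ : ∀ {e} → e ∈ˢ σ f ψ → e ≡ f ⊎ e ∈ˢ comp ψ
    ∈-σ p = ∈-∪₁⁻ (subst (_ ∈ˢ_) σ≡ p)

    comp⊆σ : ∀ {e} → e ∈ˢ comp ψ → e ∈ˢ σ f ψ
    comp⊆σ p = subst (_ ∈ˢ_) (sym σ≡) (∈-∪₁-old p)

    -- Together with `σ≡` this shows that `σ f` takes (ψ, φ) to (φ + f, ψ - f).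
    comp-σ : comp (σ f ψ) ≡ ψ ∖ f
    comp-σ = vec-ext λ i → trans (lookup∘tabulate _ i) (trans (cong (λ z → er i ∧ not z) (lookup-σ i))
               (trans (at i) (sym (lookup-∖ ψ f i))))
      where
      at : ∀ i → er i ∧ not (lookup ψ i xor (er i ∧ not (i == f))) ≡ lookup ψ i ∧ not (i == f)
      at i with i ≟ f
      ... | yes refl rewrite ∈⇒true f∈ | er-true (∈⇒true f∈) = refl
      ... | no _ with lookup ψ i in eq
      ...   | true rewrite er-true eq = refl
      ...   | false with er i
      ...     | true = refl
      ...     | false = refl

  -- ψ is the tree of a state and f is an edge of ψ joining the two trees of comp ψ (see D-crossing).
  abstract
    D : Subset m → Edge G → Bool
    D ψ f = does (tree? ψ) ∧ (lookup ψ f ∧ does (tree? (σ f ψ)))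

    D⁻ : ∀ {ψ f} → D ψ f ≡ true → Tree ψ × f ∈ˢ ψ × Tree (σ f ψ)
    D⁻ {ψ} {f} p with ∧-true {does (tree? ψ)} p
    ... | p₁ , q with ∧-true {lookup ψ f} q
    ...   | p₂ , p₃ = does⇒ (tree? ψ) p₁ , true⇒∈ p₂ , does⇒ (tree? (σ f ψ)) p₃

    D⁺ : ∀ {ψ f} → Tree ψ → f ∈ˢ ψ → Tree (σ f ψ) → D ψ f ≡ true
    D⁺ {ψ} {f} p q s = ∧-intro (dec-true (tree? ψ) p) (∧-intro (∈⇒true q) (dec-true (tree? (σ f ψ)) s))

  -- `D` asks that `ψ` and `σ f ψ` are trees and that `f` is in `ψ`, hence in both; `σ f` only
  -- interchanges the two trees.
  D-swap : ∀ ψ f → D (σ f ψ) f ≡ D ψ f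
  D-swap ψ f = ≡-by-true (λ p → subst (λ z → D z f ≡ true) (σ-σ f ψ) (forth p)) forth
    where
    forth : ∀ {ψ} → D ψ f ≡ true → D (σ f ψ) f ≡ true
    forth {ψ} p with D⁻ p
    ... | tr , f∈ , tr′ = D⁺ tr′ (f∈σ tr f∈) (subst Tree (sym (σ-σ f ψ)) tr)

  -- On the vertices of R, for a state, this is the indicator of A.
  K : Subset m → Vertex G → Bool
  K ψ = κ (comp ψ)

  module _ {ψ : Subset m} {f : Edge G} (dt : D ψ f ≡ true) where
    private
      tr = proj₁ (D⁻ dt)
      f∈ = proj₁ (proj₂ (D⁻ dt))
      tr′ = proj₂ (proj₂ (D⁻ dt))

    comp-bicolored : Bicolored (comp ψ)
    comp-bicolored = subst Bicolored (σ∖ tr f∈) (Tree⇒Bicolored tr′ (f∈σ tr f∈))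

    K-crossing : δ (K ψ) f ≡ true
    K-crossing = subst (λ F → δ (κ F) f ≡ true) (σ∖ tr f∈) (cut tr′ (f∈σ tr f∈))

    -- One exchange edge `f` already makes `comp ψ` bicolored, a property that no longer mentions
    -- `f`. So any other edge of ψ is an exchange edge iff it leaves A, and the true values of `D ψ`
    -- number k.
    D-crossing : ∀ g → D ψ g ≡ lookup ψ g ∧ δ (K ψ) g
    D-crossing g = ≡-by-true forth back
      where
      forth : D ψ g ≡ true → lookup ψ g ∧ δ (K ψ) g ≡ true
      forth p with _ , g∈ , trg ← D⁻ p =
        ∧-intro (∈⇒true g∈) (subst (λ F → δ (κ F) g ≡ true) (σ∖ tr g∈) (cut trg (f∈σ tr g∈)))
      back : lookup ψ g ∧ δ (K ψ) g ≡ true → D ψ g ≡ true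
      back p with ∧-true {lookup ψ g} p
      ... | q , δg = D⁺ tr g∈ (subst Tree (sym (σ≡ tr g∈)) (Bicolored⇒Tree comp-bicolored (proj₁ tr g g∈) δg))
        where g∈ = true⇒∈ {S = ψ} q

    -- By `D-crossing` the coefficients of `K ψ` in the basis dual to ψ are the values of `D ψ`.
    state-expand : ∀ {x} → VR x → sum (λ g → D ψ g ∧ κ (ψ ∖ g) x) ≡ K ψ x
    state-expand {x} x∈R = trans (sum-congₑ λ g → trans (cong (_∧ κ (ψ ∖ g) x) (D-crossing g)) (∧-assoc (lookup ψ g) _ _))
      (trans (sym (expand tr (K ψ) x∈R)) (trans (cong (K ψ x xor_) (κ-root (comp ψ))) (xor-identityʳ _)))

    state-expand-δ : ∀ {e} → ER e → sum (λ g → D ψ g ∧ δ (κ (ψ ∖ g)) e) ≡ δ (K ψ) e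
    state-expand-δ {e} e∈R = trans
      (sum-congₑ λ g → trans (cong (_∧ δ (κ (ψ ∖ g)) e) (D-crossing g)) (∧-assoc (lookup ψ g) _ _))
      (sym (expand-δ tr (K ψ) e∈R))

    edge-at : ∀ {x y} → VR x → VR y → x ≢ y → ∃ λ e → ER e × Incident G x e
    edge-at x∈R y∈R x≢y with proj₁ (proj₂ tr) _ _ x∈R y∈R
    ... | here = ⊥-elim (x≢y refl)
    ... | step e e∈ (inj₁ (p , _)) _ = e , proj₁ tr e e∈ , inj₁ p
    ... | step e e∈ (inj₂ (_ , p)) _ = e , proj₁ tr e e∈ , inj₂ p

    -- Each of three distinct vertices meets an edge of ψ, and `f` has only two ends. Hence `mask f`
    -- is nonzero and the exchange along `f` has no fixed point.
    other-edge : ∃ λ e → ER e × e ≢ f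
    other-edge with edge-at r∈R b∈R r≢b | edge-at b∈R r∈R (r≢b ∘ sym) | edge-at c∈R r∈R (r≢c ∘ sym)
    ... | e₁ , p₁ , i₁ | e₂ , p₂ , i₂ | e₃ , p₃ , i₃ with e₁ ≟ f | e₂ ≟ f | e₃ ≟ f
    ...   | no n | _ | _ = e₁ , p₁ , n
    ...   | yes _ | no n | _ = e₂ , p₂ , n
    ...   | yes _ | yes _ | no n = e₃ , p₃ , n
    ...   | yes refl | yes refl | yes refl = ⊥-elim (pigeonhole i₁ i₂ i₃)
      where
      pigeonhole : Incident G r f → Incident G b f → Incident G c f → ⊥
      pigeonhole (inj₁ p) (inj₁ q) _ = r≢b (trans (sym p) q)
      pigeonhole (inj₂ p) (inj₂ q) _ = r≢b (trans (sym p) q)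
      pigeonhole (inj₁ p) _ (inj₁ q) = r≢c (trans (sym p) q)
      pigeonhole (inj₂ p) _ (inj₂ q) = r≢c (trans (sym p) q)
      pigeonhole _ (inj₁ p) (inj₁ q) = b≢c (trans (sym p) q)
      pigeonhole _ (inj₂ p) (inj₂ q) = b≢c (trans (sym p) q)

  state-or-not : ∀ ψ → (∃ λ f → D ψ f ≡ true) ⊎ (∀ f → D ψ f ≡ false)
  state-or-not ψ with any? (λ f → D ψ f ≟ᵇ true)
  ... | yes p = inj₁ p
  ... | no ¬p = inj₂ λ f → ¬-not λ q → ¬p (f , q)

  -- Substituting the exchanged state for ψ is a translation, and `D-swap` preserves the range of
  -- summation.
  swap-reindex : ∀ f (H : Subset m → Bool) → Σᵥ (λ ψ → D ψ f ∧ H (σ f ψ)) ≡ Σᵥ (λ ψ → D ψ f ∧ H ψ)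
  swap-reindex f H = trans (Σᵥ-congₑ λ ψ → cong (_∧ H (σ f ψ)) (sym (D-swap ψ f)))
                           (Σᵥ-shift (λ ψ → D ψ f ∧ H ψ) (mask f))

  -- The exchange along `f` pairs the states that have `f` as an exchange edge, and `H` agrees on
  -- each pair.
  swap-invariant : ∀ f (H : Subset m → Bool) → (∀ ψ → D ψ f ≡ true → H (σ f ψ) ≡ H ψ) →
                   Σᵥ (λ ψ → D ψ f ∧ H ψ) ≡ false
  swap-invariant f H inv with any? (λ e → ER? e ×-dec ¬? (e ≟ f))
  ... | yes (e , e∈R , e≢f) = Σᵥ-shift-invariant (λ ψ → D ψ f ∧ H ψ) (mask f) e
          (trans (lookup∘tabulate _ e) (∧-intro (dec-true (ER? e) e∈R) (cong not (==-≢ e≢f))))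
          (λ ψ → trans (cong (_∧ H (σ f ψ)) (D-swap ψ f)) (∧-cong-true (inv ψ)))
  -- With `f` as the only possible edge of R there is no state, by `other-edge`.
  ... | no ¬∃ = trans (Σᵥ-congₑ λ ψ → ¬-not λ p → ⊥-elim (¬∃ (other-edge (proj₁ (∧-true p))))) (Σᵥ-false m)

  -- Since `sum (D ψ)` is k modulo 2, this counts the states with k odd; for each fixed `f` they
  -- come in pairs.
  sum-states : Σᵥ (λ ψ → sum (D ψ)) ≡ false
  sum-states = trans (Σᵥ-sum D) (sum-falseₑ λ f →
    trans (Σᵥ-congₑ λ ψ → sym (∧-identityʳ (D ψ f))) (swap-invariant f (λ _ → true) λ _ _ → refl))

  -- The exchange replaces `K ψ x` by `κ (ψ ∖ f) x`, whose sum over the exchange edges is again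
  -- `K ψ x`. Being idempotent, this value may be multiplied by `K ψ x`, and the resulting product
  -- is symmetric because the exchange interchanges its two factors. Summed over `x` in R this
  -- handles |A|.
  sum-separating : ∀ {x} → VR x → Σᵥ (λ ψ → sum λ f → D ψ f ∧ K ψ x) ≡ false
  sum-separating {x} x∈R = begin
    Σᵥ (λ ψ → sum λ f → D ψ f ∧ K ψ x) ≡⟨ Σᵥ-sum (λ ψ f → D ψ f ∧ K ψ x) ⟩
    sum (λ f → Σᵥ λ ψ → D ψ f ∧ K ψ x) ≡⟨ sum-congₑ (λ f → swap-reindex f (λ ψ → K ψ x)) ⟨
    sum (λ f → Σᵥ λ ψ → D ψ f ∧ K (σ f ψ) x)
      ≡⟨ sum-congₑ (λ f → Σᵥ-congₑ λ ψ → ∧-cong-true λ p → cong (λ F → κ F x) (swapped p)) ⟩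
    sum (λ f → Σᵥ λ ψ → D ψ f ∧ κ (ψ ∖ f) x) ≡⟨ Σᵥ-sum (λ ψ f → D ψ f ∧ κ (ψ ∖ f) x) ⟨
    Σᵥ (λ ψ → sum λ f → D ψ f ∧ κ (ψ ∖ f) x) ≡⟨ Σᵥ-congₑ square ⟩
    Σᵥ (λ ψ → sum λ f → D ψ f ∧ (κ (ψ ∖ f) x ∧ K ψ x)) ≡⟨ Σᵥ-sum (λ ψ f → D ψ f ∧ (κ (ψ ∖ f) x ∧ K ψ x)) ⟩
    sum (λ f → Σᵥ λ ψ → D ψ f ∧ (κ (ψ ∖ f) x ∧ K ψ x))
      ≡⟨ sum-falseₑ (λ f → swap-invariant f (λ ψ → κ (ψ ∖ f) x ∧ K ψ x) λ ψ p →
           trans (cong₂ (λ A B → κ A x ∧ κ B x) (unswapped p) (swapped p)) (∧-comm (K ψ x) _)) ⟩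
    false ∎
    where
    open ≡-Reasoning
    swapped : ∀ {ψ f} → D ψ f ≡ true → comp (σ f ψ) ≡ ψ ∖ f
    swapped p = comp-σ (proj₁ (D⁻ p)) (proj₁ (proj₂ (D⁻ p)))
    unswapped : ∀ {ψ f} → D ψ f ≡ true → σ f ψ ∖ f ≡ comp ψ
    unswapped p = σ∖ (proj₁ (D⁻ p)) (proj₁ (proj₂ (D⁻ p)))
    square : ∀ ψ → sum (λ f → D ψ f ∧ κ (ψ ∖ f) x) ≡ sum (λ f → D ψ f ∧ (κ (ψ ∖ f) x ∧ K ψ x))
    square ψ with state-or-not ψ
    ... | inj₂ n = trans (sum-falseₑ λ f → cong (_∧ κ (ψ ∖ f) x) (n f))
                         (sym (sum-falseₑ λ f → cong (_∧ (κ (ψ ∖ f) x ∧ K ψ x)) (n f)))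
    ... | inj₁ (_ , p) = begin
      sum (λ f → D ψ f ∧ κ (ψ ∖ f) x) ≡⟨ state-expand p x∈R ⟩
      K ψ x ≡⟨ ∧-idem (K ψ x) ⟨
      K ψ x ∧ K ψ x ≡⟨ cong (_∧ K ψ x) (state-expand p x∈R) ⟨
      sum (λ f → D ψ f ∧ κ (ψ ∖ f) x) ∧ K ψ x ≡⟨ *-distribʳ-sum (K ψ x) (λ f → D ψ f ∧ κ (ψ ∖ f) x) ⟩
      sum (λ f → (D ψ f ∧ κ (ψ ∖ f) x) ∧ K ψ x) ≡⟨ sum-congₑ (λ f → ∧-assoc (D ψ f) _ _) ⟩
      sum (λ f → D ψ f ∧ (κ (ψ ∖ f) x ∧ K ψ x)) ∎

  -- Exchanges inside A and the sum of e(ψ)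

  inside : Subset m → Edge G → Bool
  inside ψ e = K ψ (tail e) ∧ K ψ (head e)

  inside⁻ : ∀ ψ {e} → inside ψ e ≡ true → K ψ (tail e) ≡ true × K ψ (head e) ≡ true
  inside⁻ ψ {e} = ∧-true {K ψ (tail e)}

  inside-δ : ∀ ψ {e} → inside ψ e ≡ true → δ (K ψ) e ≡ false
  inside-δ ψ p = cong₂ _xor_ (proj₁ (inside⁻ ψ p)) (proj₂ (inside⁻ ψ p))

  -- The last two fields say that replacing `e` by `g` in ψ, and `g` by `e` in `σ f ψ`, again gives
  -- trees. So interchanging `e` and `g` between ψ and φ yields a state with the same exchange edge
  -- `f`.
  record Exchangeable (f : Edge G) (ψ : Subset m) (e g : Edge G) : Set where
    field
      state   : D ψ f ≡ true
      e∈ψ     : e ∈ˢ ψ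
      e-in    : inside ψ e ≡ true
      g∈comp  : g ∈ˢ comp ψ
      g-in    : inside ψ g ≡ true
      e-cross : δ (κ (σ f ψ ∖ g)) e ≡ true
      g-cross : δ (κ (ψ ∖ e)) g ≡ true

  -- Both edges lie inside A, so A does not change. Removing the new edge from either new tree
  -- leaves the same forest as removing the old edge from the old tree, so the crossing conditions
  -- trade places.
  exchange-sym : ∀ {f ψ e g} → Exchangeable f ψ e g → Exchangeable f (ψ ⊕ pair e g) g e
  exchange-sym {f} {ψ} {e} {g} ex = record
    { state   = D⁺ trψ′ f∈ψ′ trT′
    ; e∈ψ     = subst (g ∈ˢ_) (sym ψ′≡) (∈-∪₁-new g)
    ; e-in    = trans (K-inside g∈R) g-in
    ; g∈comp  = comp-∈ e∈R e∉ψ′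
    ; g-in    = trans (K-inside e∈R) e-in
    ; e-cross = subst (λ F → δ (κ F) g ≡ true) (sym T′∖e) (cut trT g∈T)
    ; g-cross = subst (λ F → δ (κ F) e ≡ true) (sym ψ′∖g) (cut tr e∈ψ)
    }
    where
    open Exchangeable ex
    tr = proj₁ (D⁻ state)
    f∈ = proj₁ (proj₂ (D⁻ state))
    trT = proj₂ (proj₂ (D⁻ state))
    ψ′ = ψ ⊕ pair e g
    T = σ f ψ
    g∉ψ = proj₂ (∈-comp {ψ} g∈comp)
    g∈R = proj₁ (∈-comp {ψ} g∈comp)
    e∈R = proj₁ tr e e∈ψ
    e≢g : e ≢ g
    e≢g refl = g∉ψ e∈ψ
    f≢e : f ≢ e
    f≢e refl = false≢true (trans (sym (inside-δ ψ e-in)) (K-crossing state))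
    g∈T = comp⊆σ tr f∈ g∈comp
    e∉T : e ∉ˢ T
    e∉T p with ∈-σ tr f∈ p
    ... | inj₁ e≡f = f≢e (sym e≡f)
    ... | inj₂ q = proj₂ (∈-comp q) e∈ψ
    ψ′≡ : ψ′ ≡ ψ ∖ e ∪₁ g
    ψ′≡ = ⊕-pair e∈ψ g∉ψ
    -- `σ f` and the exchange of `e` and `g` are both translations and therefore commute.
    T′≡ : σ f ψ′ ≡ T ∖ g ∪₁ e
    T′≡ = trans (⊕-swap ψ (pair e g) (mask f)) (trans (cong (T ⊕_) (pair-comm e g)) (⊕-pair g∈T e∉T))
    trψ′ : Tree ψ′
    trψ′ = subst Tree (sym ψ′≡) (exchange tr e∈ψ g∈R g-cross)
    trT′ : Tree (σ f ψ′)
    trT′ = subst Tree (sym T′≡) (exchange trT g∈T e∈R e-cross)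
    f∈ψ′ : f ∈ˢ ψ′
    f∈ψ′ = subst (f ∈ˢ_) (sym ψ′≡) (∈-∪₁-old (∈-∖⁺ f∈ f≢e))
    e∉ψ′ : e ∉ˢ ψ′
    e∉ψ′ p with ∈-∪₁⁻ (subst (e ∈ˢ_) ψ′≡ p)
    ... | inj₁ e≡g = e≢g e≡g
    ... | inj₂ q = proj₂ (∈-∖⁻ q) refl
    ψ′∖g : ψ′ ∖ g ≡ ψ ∖ e
    ψ′∖g = trans (cong (_∖ g) ψ′≡) (∖-∪₁ (g∉ψ ∘ proj₁ ∘ ∈-∖⁻))
    T′∖e : σ f ψ′ ∖ e ≡ T ∖ g
    T′∖e = trans (cong (_∖ e) T′≡) (∖-∪₁ (e∉T ∘ proj₁ ∘ ∈-∖⁻))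
    -- The new tree consists of `f`, which crosses for both functions, of `e`, which lies inside A,
    -- and of edges of φ; so `unique` applies.
    same-δ : ∀ i → i ∈ˢ σ f ψ′ → δ (K ψ′) i ≡ δ (K ψ) i
    same-δ i i∈ with ∈-σ trψ′ f∈ψ′ i∈
    ... | inj₁ refl = trans (K-crossing (D⁺ trψ′ f∈ψ′ trT′)) (sym (K-crossing state))
    ... | inj₂ i∈comp with ∈-∪₁⁻ (subst (i ∈ˢ_) T′≡ i∈)
    ...   | inj₁ refl = trans (κ-const i∈comp) (sym (inside-δ ψ e-in))
    ...   | inj₂ q with ∈-σ tr f∈ (proj₁ (∈-∖⁻ q))
    ...     | inj₁ refl = ⊥-elim (proj₂ (∈-comp i∈comp) f∈ψ′)
    ...     | inj₂ i∈comp′ = trans (κ-const i∈comp) (sym (κ-const i∈comp′))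
    K-same : ∀ {x} → VR x → K ψ′ x ≡ K ψ x
    K-same = unique trT′ (K ψ′) (K ψ) (trans (κ-root (comp ψ′)) (sym (κ-root (comp ψ)))) same-δ
    K-inside : ∀ {i} → ER i → inside ψ′ i ≡ inside ψ i
    K-inside (p , q) = cong₂ _∧_ (K-same p) (K-same q)

  -- The factors free of `g` come first, so that they leave the sum over `g`.
  exchangeable : Edge G → Subset m → Edge G → Edge G → Bool
  exchangeable f ψ e g = D ψ f ∧ ((lookup ψ e ∧ inside ψ e) ∧
    (lookup (comp ψ) g ∧ (inside ψ g ∧ (δ (κ (ψ ∖ e)) g ∧ δ (κ (σ f ψ ∖ g)) e))))

  exchangeable⁻ : ∀ {f ψ e g} → exchangeable f ψ e g ≡ true → Exchangeable f ψ e g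
  exchangeable⁻ {f} {ψ} {e} {g} p
    with p₁ , q₁ ← ∧-true {D ψ f} p
    with pe , q₂ ← ∧-true {lookup ψ e ∧ inside ψ e} q₁
    with p₂ , p₃ ← ∧-true {lookup ψ e} pe
    with p₄ , q₃ ← ∧-true {lookup (comp ψ) g} q₂
    with p₅ , q₄ ← ∧-true {inside ψ g} q₃
    with p₆ , p₇ ← ∧-true {δ (κ (ψ ∖ e)) g} q₄ = record
    { state = p₁ ; e∈ψ = true⇒∈ p₂ ; e-in = p₃ ; g∈comp = true⇒∈ p₄ ; g-in = p₅ ; e-cross = p₇ ; g-cross = p₆ }

  exchangeable⁺ : ∀ {f ψ e g} → Exchangeable f ψ e g → exchangeable f ψ e g ≡ true
  exchangeable⁺ ex = ∧-intro state (∧-intro (∧-intro (∈⇒true e∈ψ) e-in)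
      (∧-intro (∈⇒true g∈comp) (∧-intro g-in (∧-intro g-cross e-cross))))
    where open Exchangeable ex

  exchangeable-sym : ∀ f ψ e g → exchangeable f (ψ ⊕ pair e g) g e ≡ exchangeable f ψ e g
  exchangeable-sym f ψ e g = ≡-by-true
    (λ p → subst (λ z → exchangeable f z e g ≡ true)
             (trans (cong (ψ ⊕ pair e g ⊕_) (pair-comm g e)) (⊕-self ψ (pair e g)))
             (exchangeable⁺ (exchange-sym (exchangeable⁻ p))))
    (λ p → exchangeable⁺ (exchange-sym (exchangeable⁻ p)))

  -- The product K·κ(ψ ∖ e) changes across e; expanding it along σ f ψ counts the admissible g.
  exchange-count : ∀ {f ψ e} → D ψ f ≡ true → lookup ψ e ∧ inside ψ e ≡ true →
    sum (λ g → lookup (comp ψ) g ∧ (inside ψ g ∧ (δ (κ (ψ ∖ e)) g ∧ δ (κ (σ f ψ ∖ g)) e))) ≡ true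
  exchange-count {f} {ψ} {e} state pe = trans (sum-congₑ term) (trans (sym (expand-δ trT χ (proj₁ tr e e∈))) χe)
    where
    tr = proj₁ (D⁻ state)
    f∈ = proj₁ (proj₂ (D⁻ state))
    trT = proj₂ (proj₂ (D⁻ state))
    T = σ f ψ
    e∈ = true⇒∈ {S = ψ} (proj₁ (∧-true {lookup ψ e} pe))
    e-in = proj₂ (∧-true {lookup ψ e} pe)
    χ : Vertex G → Bool
    χ x = K ψ x ∧ κ (ψ ∖ e) x
    χe : δ χ e ≡ true
    χe = trans (cong₂ (λ p q → (p ∧ κ (ψ ∖ e) (tail e)) xor (q ∧ κ (ψ ∖ e) (head e)))
                 (proj₁ (inside⁻ ψ e-in)) (proj₂ (inside⁻ ψ e-in))) (cut tr e∈)
    product-δ : ∀ k k′ p q → k xor k′ ≡ false → (k ∧ k′) ∧ (p xor q) ≡ (k ∧ p) xor (k′ ∧ q)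
    product-δ false false p q _ = refl
    product-δ true true p q _ = refl
    term : ∀ g → lookup (comp ψ) g ∧ (inside ψ g ∧ (δ (κ (ψ ∖ e)) g ∧ δ (κ (T ∖ g)) e))
               ≡ lookup T g ∧ (δ χ g ∧ δ (κ (T ∖ g)) e)
    term g with lookup (comp ψ) g in eq
    ... | true = begin
      inside ψ g ∧ (δ (κ (ψ ∖ e)) g ∧ δ (κ (T ∖ g)) e) ≡⟨ ∧-assoc (inside ψ g) _ _ ⟨
      (inside ψ g ∧ δ (κ (ψ ∖ e)) g) ∧ δ (κ (T ∖ g)) e
        ≡⟨ cong (_∧ δ (κ (T ∖ g)) e) (product-δ (K ψ (tail g)) (K ψ (head g)) _ _ (κ-const g∈)) ⟩
      δ χ g ∧ δ (κ (T ∖ g)) e ≡⟨ cong (_∧ (δ χ g ∧ δ (κ (T ∖ g)) e)) (∈⇒true (comp⊆σ tr f∈ g∈)) ⟨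
      lookup T g ∧ (δ χ g ∧ δ (κ (T ∖ g)) e) ∎
      where
      open ≡-Reasoning
      g∈ = true⇒∈ {S = comp ψ} eq
    ... | false with g ≟ f
    -- The edge `f` belongs to `T` but not to φ. It adds nothing: `T ∖ f` is φ, and `K ψ` does not
    -- change across `e`, which lies inside A.
    ...   | yes refl = sym (trans (cong (λ F → lookup T f ∧ (δ χ f ∧ δ (κ F) e)) (σ∖ tr f∈))
              (trans (cong (λ z → lookup T f ∧ (δ χ f ∧ z)) (inside-δ ψ e-in))
                (trans (cong (lookup T f ∧_) (∧-zeroʳ _)) (∧-zeroʳ _))))
    ...   | no g≢f = sym (cong (_∧ (δ χ g ∧ δ (κ (T ∖ g)) e)) (∉⇒false
              λ g∈T → [ g≢f , (λ q → false⇒∉ eq q) ]′ (∈-σ tr f∈ g∈T)))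

  -- For fixed `f`, `exchange-count` replaces each edge `e` of ψ inside A by the odd number of its
  -- partners `g`. Exchanging `e` and `g` makes the number of states symmetric modulo 2 in the two
  -- edges, with zero diagonal.
  sum-inside : Σᵥ (λ ψ → sum λ f → D ψ f ∧ sum (λ e → lookup ψ e ∧ inside ψ e)) ≡ false
  sum-inside = trans (Σᵥ-sum (λ ψ f → D ψ f ∧ sum (λ e → lookup ψ e ∧ inside ψ e))) (sum-falseₑ per-edge)
    where
    open ≡-Reasoning
    count : ∀ f ψ e → D ψ f ∧ (lookup ψ e ∧ inside ψ e) ≡ sum (exchangeable f ψ e)
    count f ψ e = sym (begin
      sum (λ g → D ψ f ∧ ((lookup ψ e ∧ inside ψ e) ∧ X g)) ≡⟨ *-distribˡ-sum (D ψ f) (λ g → (lookup ψ e ∧ inside ψ e) ∧ X g) ⟨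
      D ψ f ∧ sum (λ g → (lookup ψ e ∧ inside ψ e) ∧ X g) ≡⟨ cong (D ψ f ∧_) (*-distribˡ-sum (lookup ψ e ∧ inside ψ e) X) ⟨
      D ψ f ∧ ((lookup ψ e ∧ inside ψ e) ∧ sum X)
        ≡⟨ ∧-cong-true {D ψ f} (λ p → trans (∧-cong-true {lookup ψ e ∧ inside ψ e} (λ q → exchange-count p q)) (∧-identityʳ _)) ⟩
      D ψ f ∧ (lookup ψ e ∧ inside ψ e) ∎)
      where
      X : Edge G → Bool
      X g = lookup (comp ψ) g ∧ (inside ψ g ∧ (δ (κ (ψ ∖ e)) g ∧ δ (κ (σ f ψ ∖ g)) e))
    per-edge : ∀ f → Σᵥ (λ ψ → D ψ f ∧ sum (λ e → lookup ψ e ∧ inside ψ e)) ≡ false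
    per-edge f = begin
      Σᵥ (λ ψ → D ψ f ∧ sum (λ e → lookup ψ e ∧ inside ψ e))
        ≡⟨ Σᵥ-congₑ (λ ψ → trans (*-distribˡ-sum (D ψ f) (λ e → lookup ψ e ∧ inside ψ e)) (sum-congₑ (count f ψ))) ⟩
      Σᵥ (λ ψ → sum λ e → sum (exchangeable f ψ e)) ≡⟨ Σᵥ-sum (λ ψ e → sum (exchangeable f ψ e)) ⟩
      sum (λ e → Σᵥ λ ψ → sum (exchangeable f ψ e)) ≡⟨ sum-congₑ (λ e → Σᵥ-sum (λ ψ g → exchangeable f ψ e g)) ⟩
      sum (λ e → sum λ g → Σᵥ λ ψ → exchangeable f ψ e g) ≡⟨ sum-symmetric (λ e g → Σᵥ λ ψ → exchangeable f ψ e g) symm diag ⟩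
      false ∎
      where
      symm : ∀ e g → Σᵥ (λ ψ → exchangeable f ψ e g) ≡ Σᵥ (λ ψ → exchangeable f ψ g e)
      symm e g = trans (Σᵥ-congₑ λ ψ → sym (exchangeable-sym f ψ e g))
                       (Σᵥ-shift (λ ψ → exchangeable f ψ g e) (pair e g))
      diag : ∀ e → Σᵥ (λ ψ → exchangeable f ψ e e) ≡ false
      diag e = trans (Σᵥ-congₑ λ ψ → ¬-not λ p →
        let open Exchangeable (exchangeable⁻ p) in ⊥-elim (proj₂ (∈-comp g∈comp) e∈ψ)) (Σᵥ-false m)

  -- The edge set of the cycle of T ∪ {e}.
  cycle : Subset m → Edge G → Edge G → Bool
  cycle T e g = (g == e) ∨ (lookup T g ∧ δ (κ (T ∖ g)) e)

  -- The least edge is a choice that depends on the cycle alone, hence is common to `σ e ψ` with `f`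
  -- and `σ f ψ` with `e`.
  base : Subset m → Edge G → Edge G
  base T e = find (cycle T e) e

  tree-κ : ∀ {T x} → Tree T → VR x → κ T x ≡ false
  tree-κ {T} (_ , con , _) x∈R = trans (κ-Reach (con _ r x∈R r∈R)) (κ-root T)

  ∖-∉ : ∀ {S : Subset m} {g} → g ∉ˢ S → S ∖ g ≡ S
  ∖-∉ {S} {g} g∉ = vec-ext λ i → trans (lookup-∖ S g i) (at i)
    where
    at : ∀ i → lookup S i ∧ not (i == g) ≡ lookup S i
    at i with i ≟ g
    ... | yes refl rewrite ∉⇒false g∉ = refl
    ... | no _ = ∧-identityʳ _

  ∨-trueˡ : ∀ {x y} → x ≡ true → x ∨ y ≡ true
  ∨-trueˡ refl = refl

  module _ {ψ : Subset m} {e f : Edge G} (De : D ψ e ≡ true) (Df : D ψ f ≡ true) (e≢f : e ≢ f) where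
    private
      tr = proj₁ (D⁻ De)
      e∈ = proj₁ (proj₂ (D⁻ De))
      f∈ = proj₁ (proj₂ (D⁻ Df))
      trE = proj₂ (proj₂ (D⁻ De))
      trF = proj₂ (proj₂ (D⁻ Df))

    σ-∉ : e ∉ˢ σ f ψ
    σ-∉ p with ∈-σ tr f∈ p
    ... | inj₁ e≡f = e≢f e≡f
    ... | inj₂ q = proj₂ (∈-comp q) e∈

    -- If `e` does not cross the cut of `g` in φ + f, that cut has the same changes along φ + e as
    -- the cut of `g` there. By `unique` the two cuts agree on R, and the first is constant across
    -- `f`.
    cycle-false : ∀ {g} → g ∈ˢ comp ψ → δ (κ (σ f ψ ∖ g)) e ≡ false → δ (κ (σ e ψ ∖ g)) f ≡ false
    cycle-false {g} g∈ δe = trans (cong₂ _xor_ (same (proj₁ f∈R)) (same (proj₂ f∈R))) (κ-const f∈T∖g)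
      where
      f∈R = proj₁ tr f f∈
      f∈T∖g : f ∈ˢ (σ f ψ ∖ g)
      f∈T∖g = ∈-∖⁺ (f∈σ tr f∈) λ { refl → proj₂ (∈-comp g∈) f∈ }
      same-δ : ∀ i → i ∈ˢ σ e ψ → δ (κ (σ e ψ ∖ g)) i ≡ δ (κ (σ f ψ ∖ g)) i
      same-δ i i∈ with i ≟ g | ∈-σ tr e∈ i∈
      ... | yes refl | _ = trans (cut trE i∈) (sym (cut trF (comp⊆σ tr f∈ g∈)))
      ... | no i≢g | inj₁ refl = trans (κ-const (∈-∖⁺ i∈ i≢g)) (sym δe)
      ... | no i≢g | inj₂ i∈comp = trans (κ-const (∈-∖⁺ i∈ i≢g)) (sym (κ-const (∈-∖⁺ (comp⊆σ tr f∈ i∈comp) i≢g)))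
      same : ∀ {x} → VR x → κ (σ e ψ ∖ g) x ≡ κ (σ f ψ ∖ g) x
      same = unique trE _ _ (trans (κ-root (σ e ψ ∖ g)) (sym (κ-root (σ f ψ ∖ g)))) same-δ

    -- Both sides describe the cycle of φ + e + f. Interchanging `e` and `f` gives the reverse
    -- inclusion.
    cycle-⊆ : ∀ g → cycle (σ e ψ) f g ≡ true → cycle (σ f ψ) e g ≡ true
    cycle-⊆ g p with g ≟ e
    ... | yes _ = refl
    ... | no g≢e with g ≟ f
    ...   | yes refl = ∧-intro (∈⇒true (f∈σ tr f∈)) (trans (cong (λ F → δ (κ F) e) (σ∖ tr f∈)) (K-crossing De))
    ...   | no g≢f with ∧-true {lookup (σ e ψ) g} p
    ...     | g∈ , δf with ∈-σ tr e∈ (true⇒∈ g∈)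
    ...       | inj₁ g≡e = ⊥-elim (g≢e g≡e)
    ...       | inj₂ g∈comp = ∧-intro (∈⇒true (comp⊆σ tr f∈ g∈comp)) crossing
      where
      crossing : δ (κ (σ f ψ ∖ g)) e ≡ true
      crossing with δ (κ (σ f ψ ∖ g)) e in eq
      ... | true = refl
      ... | false = trans (sym (cycle-false g∈comp eq)) δf

  module _ {ψ : Subset m} {e f : Edge G} (De : D ψ e ≡ true) (Df : D ψ f ≡ true) (e≢f : e ≢ f) where
    private
      tr = proj₁ (D⁻ De)
      e∈ = proj₁ (proj₂ (D⁻ De))
      f∈ = proj₁ (proj₂ (D⁻ Df))
      trE = proj₂ (proj₂ (D⁻ De))
      trF = proj₂ (proj₂ (D⁻ Df))
      e₀ = base (σ f ψ) e
      cycle-≡ : ∀ g → cycle (σ f ψ) e g ≡ cycle (σ e ψ) f g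
      cycle-≡ g = ≡-by-true (cycle-⊆ Df De (e≢f ∘ sym) g) (cycle-⊆ De Df e≢f g)
      e∈cycle : cycle (σ f ψ) e e ≡ true
      e∈cycle = ∨-trueˡ (==-refl e)
      f∈cycle : cycle (σ e ψ) f f ≡ true
      f∈cycle = ∨-trueˡ (==-refl f)

    base-≡ : base (σ e ψ) f ≡ base (σ f ψ) e
    base-≡ = sym (find-cong _ _ e f e∈cycle f∈cycle cycle-≡)

    -- The identity holds with any edge of the cycle of φ + e + f in place of the base edge;
    -- `unique` along φ + f compares the changes. The base edge makes the choice canonical, so the
    -- two summands arise from each other by interchanging `e` and `f`.
    base-sum : ∀ {x} → VR x → K ψ x ≡ κ (σ f ψ ∖ base (σ f ψ) e) x xor κ (σ e ψ ∖ base (σ e ψ) f) x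
    base-sum {x} x∈R = trans (at e₀ (find-true (cycle (σ f ψ) e) e e∈cycle))
                             (cong (λ i → κ (σ f ψ ∖ e₀) x xor κ (σ e ψ ∖ i) x) (sym base-≡))
      where
      at : ∀ g → cycle (σ f ψ) e g ≡ true → K ψ x ≡ κ (σ f ψ ∖ g) x xor κ (σ e ψ ∖ g) x
      at g p with g ≟ e | g ≟ f | cycle-≡ g
      -- Removing `e` leaves φ + f unchanged, so the first cut vanishes on R, and the second is
      -- `K ψ` itself.
      ... | yes refl | _ | _ = sym (cong₂ _xor_
              (trans (cong (λ F → κ F x) (∖-∉ (σ-∉ De Df e≢f))) (tree-κ trF x∈R))
              (cong (λ F → κ F x) (σ∖ tr e∈)))
      ... | no _ | yes refl | _ = sym (trans (cong₂ _xor_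
              (cong (λ F → κ F x) (σ∖ tr f∈))
              (trans (cong (λ F → κ F x) (∖-∉ (σ-∉ Df De (e≢f ∘ sym)))) (tree-κ trE x∈R))) (xor-identityʳ _))
      ... | no g≢e | no g≢f | eq with ∧-true {lookup (σ f ψ) g} p | ∧-true {lookup (σ e ψ) g} (trans (sym eq) p)
      ...   | g∈F , δe | g∈E , δf = unique trF (K ψ) (λ y → κ (σ f ψ ∖ g) y xor κ (σ e ψ ∖ g) y)
                (trans (κ-root (comp ψ)) (sym (cong₂ _xor_ (κ-root (σ f ψ ∖ g)) (κ-root (σ e ψ ∖ g)))))
                (λ i i∈ → trans (same-δ i i∈) (sym (δ-xor (κ (σ f ψ ∖ g)) (κ (σ e ψ ∖ g)) i))) x∈R
        where
        same-δ : ∀ i → i ∈ˢ σ f ψ → δ (K ψ) i ≡ δ (κ (σ f ψ ∖ g)) i xor δ (κ (σ e ψ ∖ g)) i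
        same-δ i i∈ with ∈-σ tr f∈ i∈ | i ≟ g
        ... | inj₁ i≡f | yes i≡g = ⊥-elim (g≢f (trans (sym i≡g) i≡f))
        ... | inj₁ refl | no i≢g = trans (K-crossing Df) (sym (cong₂ _xor_ (κ-const (∈-∖⁺ i∈ i≢g)) δf))
        ... | inj₂ i∈comp | yes refl = trans (κ-const i∈comp)
                (sym (cong₂ _xor_ (cut trF (true⇒∈ g∈F)) (cut trE (true⇒∈ g∈E))))
        ... | inj₂ i∈comp | no i≢g = trans (κ-const i∈comp)
                (sym (cong₂ _xor_ (κ-const (∈-∖⁺ i∈ i≢g)) (κ-const (∈-∖⁺ (comp⊆σ tr e∈ i∈comp) i≢g))))

  <₂-irrefl : ∀ {n} (i : Fin n) → i <₂ i ≡ false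
  <₂-irrefl zero = refl
  <₂-irrefl (suc i) = <₂-irrefl i

  -- By `base-sum` each unordered pair splits into two ordered ones. For fixed `e`, the state is
  -- reindexed by its exchange T along `f`; then `f` enters only as an edge leaving A that lies on
  -- the cycle of T + e, and a cycle meets a cut evenly.
  sum-pairs : ∀ {x} → VR x → Σᵥ (λ ψ → pairs (D ψ) ∧ K ψ x) ≡ false
  sum-pairs {x} x∈R = begin
    Σᵥ (λ ψ → pairs (D ψ) ∧ K ψ x) ≡⟨ Σᵥ-congₑ antisymmetrise ⟩
    Σᵥ (λ ψ → sum λ e → sum λ f → not (e == f) ∧ Y ψ e f) ≡⟨ Σᵥ-sum (λ ψ e → sum λ f → not (e == f) ∧ Y ψ e f) ⟩
    sum (λ e → Σᵥ λ ψ → sum λ f → not (e == f) ∧ Y ψ e f)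
      ≡⟨ sum-congₑ (λ e → trans (Σᵥ-sum λ ψ f → not (e == f) ∧ Y ψ e f)
                         (trans (sum-congₑ (reindex e)) (sym (Σᵥ-sum λ T f → D T f ∧ Z e T f)))) ⟩
    sum (λ e → Σᵥ λ T → sum λ f → D T f ∧ Z e T f) ≡⟨ sum-falseₑ (λ e → trans (Σᵥ-congₑ (vanish e)) (Σᵥ-false m)) ⟩
    false ∎
    where
    open ≡-Reasoning
    u : Subset m → Edge G → Bool
    u T e = κ (T ∖ base T e) x
    Y : Subset m → Edge G → Edge G → Bool
    Y ψ e f = D ψ f ∧ (D ψ e ∧ u (σ f ψ) e)
    -- After reindexing, `D ψ e` has become: `e` lies in `comp T` and crosses `T ∖ f`. The cut value
    -- `u T e` no longer involves `f`.
    Z : Edge G → Subset m → Edge G → Bool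
    Z e T f = (lookup (comp T) e ∧ u T e) ∧ δ (κ (T ∖ f)) e

    split : ∀ ψ e f → e <₂ f ∧ ((D ψ e ∧ D ψ f) ∧ K ψ x) ≡ e <₂ f ∧ (Y ψ e f xor Y ψ f e)
    split ψ e f = ∧-cong-true {e <₂ f} λ lt → both lt
      where
      collect : ∀ p q s t → (p ∧ q) ∧ (s xor t) ≡ (q ∧ (p ∧ s)) xor (p ∧ (q ∧ t))
      collect false false s t = refl
      collect false true s t = refl
      collect true false s t = refl
      collect true true s t = refl
      both : e <₂ f ≡ true → (D ψ e ∧ D ψ f) ∧ K ψ x ≡ Y ψ e f xor Y ψ f e
      both lt = trans (∧-cong-true {D ψ e ∧ D ψ f} λ p →
          base-sum (proj₁ (∧-true {D ψ e} p)) (proj₂ (∧-true {D ψ e} p))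
            (λ { refl → false≢true (trans (sym (<₂-irrefl e)) lt) }) x∈R)
        (collect (D ψ e) (D ψ f) _ _)

    antisymmetrise : ∀ ψ → pairs (D ψ) ∧ K ψ x ≡ sum (λ e → sum λ f → not (e == f) ∧ Y ψ e f)
    antisymmetrise ψ = begin
      pairs (D ψ) ∧ K ψ x ≡⟨ *-distribʳ-sum (K ψ x) (λ e → sum λ f → e <₂ f ∧ (D ψ e ∧ D ψ f)) ⟩
      sum (λ e → sum (λ f → e <₂ f ∧ (D ψ e ∧ D ψ f)) ∧ K ψ x)
        ≡⟨ sum-congₑ (λ e → trans (*-distribʳ-sum (K ψ x) (λ f → e <₂ f ∧ (D ψ e ∧ D ψ f)))
             (sum-congₑ λ f → trans (∧-assoc (e <₂ f) _ _) (split ψ e f))) ⟩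
      sum (λ e → sum λ f → e <₂ f ∧ (Y ψ e f xor Y ψ f e)) ≡⟨ sum-ordered-pairs (Y ψ) ⟩
      sum (λ e → sum λ f → not (e == f) ∧ Y ψ e f) ∎

    reindex : ∀ e f → Σᵥ (λ ψ → not (e == f) ∧ Y ψ e f) ≡ Σᵥ (λ T → D T f ∧ Z e T f)
    reindex e f = begin
      Σᵥ (λ ψ → not (e == f) ∧ Y ψ e f) ≡⟨ Σᵥ-congₑ (λ ψ → trans (∧-swap (not (e == f)) (D ψ f) _)
          (cong (λ z → D ψ f ∧ (not (e == f) ∧ (D z e ∧ u (σ f ψ) e))) (sym (σ-σ f ψ)))) ⟩
      Σᵥ (λ ψ → D ψ f ∧ H (σ f ψ)) ≡⟨ swap-reindex f H ⟩
      Σᵥ (λ T → D T f ∧ H T) ≡⟨ Σᵥ-congₑ (λ T → ∧-cong-true {D T f} (crossing T)) ⟩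
      Σᵥ (λ T → D T f ∧ Z e T f) ∎
      where
      H : Subset m → Bool
      H T = not (e == f) ∧ (D (σ f T) e ∧ u T e)
      swap∧′ : ∀ p q s → (p ∧ q) ∧ s ≡ (p ∧ s) ∧ q
      swap∧′ false q s = refl
      swap∧′ true q s = ∧-comm q s
      crossing : ∀ T → D T f ≡ true → H T ≡ Z e T f
      crossing T p = step₁ (e ≟ f)
        where
        trT = proj₁ (D⁻ p)
        f∈T = proj₁ (proj₂ (D⁻ p))
        Dσ : D (σ f T) e ≡ lookup (σ f T) e ∧ δ (κ (T ∖ f)) e
        Dσ = trans (D-crossing (trans (D-swap T f) p) e)
                   (cong (λ F → lookup (σ f T) e ∧ δ (κ F) e) (comp-σ trT f∈T))
        step₁ : Dec (e ≡ f) → H T ≡ Z e T f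
        step₁ (yes refl) = trans (cong (λ z → not z ∧ (D (σ f T) e ∧ u T e)) (==-refl e))
          (sym (cong (λ z → (z ∧ u T e) ∧ δ (κ (T ∖ f)) e) (∉⇒false (f∉comp trT f∈T))))
        step₁ (no e≢f) = begin
          not (e == f) ∧ (D (σ f T) e ∧ u T e) ≡⟨ cong (λ z → not z ∧ (D (σ f T) e ∧ u T e)) (==-≢ e≢f) ⟩
          D (σ f T) e ∧ u T e ≡⟨ cong (_∧ u T e) Dσ ⟩
          (lookup (σ f T) e ∧ δ (κ (T ∖ f)) e) ∧ u T e ≡⟨ swap∧′ (lookup (σ f T) e) _ _ ⟩
          (lookup (σ f T) e ∧ u T e) ∧ δ (κ (T ∖ f)) e ≡⟨ cong (λ z → (z ∧ u T e) ∧ δ (κ (T ∖ f)) e) off ⟩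
          Z e T f ∎
          where
          off : lookup (σ f T) e ≡ lookup (comp T) e
          off = ≡-by-true (λ q → ∈⇒true ([ (λ e≡f → ⊥-elim (e≢f e≡f)) , (λ z → z) ]′ (∈-σ trT f∈T (true⇒∈ q))))
                          (λ q → ∈⇒true (comp⊆σ trT f∈T (true⇒∈ q)))

    vanish : ∀ e T → sum (λ f → D T f ∧ Z e T f) ≡ false
    vanish e T with state-or-not T
    ... | inj₂ n = sum-falseₑ λ f → cong (_∧ Z e T f) (n f)
    ... | inj₁ (_ , p) = begin
      sum (λ f → D T f ∧ Z e T f) ≡⟨ sum-congₑ (λ f → ∧-swap (D T f) (lookup (comp T) e ∧ u T e) (δ (κ (T ∖ f)) e)) ⟩
      sum (λ f → (lookup (comp T) e ∧ u T e) ∧ (D T f ∧ δ (κ (T ∖ f)) e))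
        ≡⟨ *-distribˡ-sum (lookup (comp T) e ∧ u T e) (λ f → D T f ∧ δ (κ (T ∖ f)) e) ⟨
      (lookup (comp T) e ∧ u T e) ∧ sum (λ f → D T f ∧ δ (κ (T ∖ f)) e)
        -- The sum is the change of `K T` across `e`, and an edge of the forest does not leave A.
        ≡⟨ ∧-cong-true {lookup (comp T) e ∧ u T e} (λ q → let e∈ = true⇒∈ {S = comp T} (proj₁ (∧-true {lookup (comp T) e} q)) in
             trans (state-expand-δ p (proj₁ (∈-comp {T} e∈))) (κ-const e∈)) ⟩
      (lookup (comp T) e ∧ u T e) ∧ false ≡⟨ ∧-zeroʳ _ ⟩
      false ∎

-- Sums of natural numbers

ℕΣ-zero : ∀ {n} {f : Fin n → ℕ} → (∀ i → f i ≡ 0) → ℕΣ.sum f ≡ 0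
ℕΣ-zero {n} f≡0 = trans (ℕΣ.sum-cong-≗ f≡0) (ℕΣ.sum-replicate-zero n)

ℕΣ-indicator : ∀ {n} (i : Fin n) (k : Fin n → ℕ) → ℕΣ.sum (λ j → ⟦ i == j ⟧ * k j) ≡ k i
ℕΣ-indicator {suc n} zero k =
  trans (cong₂ _+_ (+-identityʳ (k zero)) (ℕΣ-zero {n} λ _ → refl)) (+-identityʳ (k zero))
ℕΣ-indicator (suc i) k = trans (ℕΣ.sum-cong-≗ λ j → cong (λ z → ⟦ z ⟧ * k (suc j)) (suc-== i j)) (ℕΣ-indicator i (k ∘ suc))
  where
  suc-== : ∀ {n} (i j : Fin n) → suc i == suc j ≡ i == j
  suc-== i j = does-⇔ (suc i ≟ suc j) (i ≟ j) suc-injective (cong suc)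

odd-ℕΣ : ∀ {n} (b : Fin n → Bool) → odd (ℕΣ.sum (⟦_⟧ ∘ b)) ≡ sum b
odd-ℕΣ {zero} b = refl
odd-ℕΣ {suc n} b with b zero
... | true  = cong not (odd-ℕΣ (b ∘ suc))
... | false = odd-ℕΣ (b ∘ suc)

ℕΣ-mono : ∀ {n} (f g : Fin n → ℕ) → (∀ i → g i ≤ f i) → ℕΣ.sum g ≤ ℕΣ.sum f
ℕΣ-mono {zero} f g le = z≤n
ℕΣ-mono {suc n} f g le = +-mono-≤ (le zero) (ℕΣ-mono (f ∘ suc) (g ∘ suc) (le ∘ suc))

-- An excess at one index could not be made up by the others. It serves to show that four known
-- edges are all the edges at a vertex.
ℕΣ-tight : ∀ {n} (f g : Fin n → ℕ) → (∀ i → g i ≤ f i) → ℕΣ.sum f ≡ ℕΣ.sum g → ∀ i → f i ≡ g i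
ℕΣ-tight {suc n} f g le eq = at
  where
  rest : ℕΣ.sum (g ∘ suc) ≤ ℕΣ.sum (f ∘ suc)
  rest = ℕΣ-mono (f ∘ suc) (g ∘ suc) (le ∘ suc)
  first : f zero ≡ g zero
  first = ≤-antisym (+-cancelʳ-≤ (ℕΣ.sum (g ∘ suc)) (f zero) (g zero)
            (≤-trans (+-monoʳ-≤ (f zero) rest) (≤-reflexive eq))) (le zero)
  at : ∀ i → f i ≡ g i
  at zero = first
  at (suc i) = ℕΣ-tight (f ∘ suc) (g ∘ suc) (le ∘ suc)
    (+-cancelˡ-≡ (f zero) _ _ (trans eq (cong (_+ ℕΣ.sum (g ∘ suc)) (sym first)))) i

length-filter-tabulate : ∀ {A : Set} {P : A → Set} (P? : ∀ x → Dec (P x)) {n} (f : Fin n → A) →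
  length (filter P? (tabulateₗ f)) ≡ ℕΣ.sum (λ i → ⟦ does (P? (f i)) ⟧)
length-filter-tabulate P? {zero} f = refl
length-filter-tabulate P? {suc n} f with P? (f zero)
... | yes _ = cong suc (length-filter-tabulate P? (f ∘ suc))
... | no _ = length-filter-tabulate P? (f ∘ suc)

odd-double : ∀ n → odd (2 * n) ≡ false
odd-double n = trans (odd-+ n (n + 0)) (trans (cong (odd n xor_) (cong odd (+-identityʳ n))) (xor-same (odd n)))

odd-⟦⟧ : ∀ b → odd ⟦ b ⟧ ≡ b
odd-⟦⟧ true = refl
odd-⟦⟧ false = refl

-- Comparing the lowest digits of two counts

module Mod4 (k s E N q q′ : ℕ) (L P L′ P′ : Bool)
  (k≡ : k ≡ ⟦ L ⟧ + 2 * ⟦ P ⟧ + 4 * q) (s≡ : s ≡ ⟦ L′ ⟧ + 2 * ⟦ P′ ⟧ + 4 * q′)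
  (total : k + 2 * E + s ≡ 4 * N) where
  open +-*-Solver using (solve; _:+_; _:*_; _:=_; con)

  private
    shape : ∀ l l′ p p′ → (l + 2 * p + 4 * q) + 2 * E + (l′ + 2 * p′ + 4 * q′) ≡
            (l + l′) + 2 * (E + (p + p′) + 2 * (q + q′))
    shape l l′ p p′ = solve 7 (λ l l′ p p′ q q′ E →
      (l :+ con 2 :* p :+ con 4 :* q) :+ con 2 :* E :+ (l′ :+ con 2 :* p′ :+ con 4 :* q′) :=
      (l :+ l′) :+ con 2 :* (E :+ (p :+ p′) :+ con 2 :* (q :+ q′))) refl l l′ p p′ q q′ E

    equation : (⟦ L ⟧ + ⟦ L′ ⟧) + 2 * (E + (⟦ P ⟧ + ⟦ P′ ⟧) + 2 * (q + q′)) ≡ 4 * N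
    equation = trans (sym (shape ⟦ L ⟧ ⟦ L′ ⟧ ⟦ P ⟧ ⟦ P′ ⟧)) (trans (sym (cong₂ (λ x y → x + 2 * E + y) k≡ s≡)) total)

    four : 4 * N ≡ 2 * (2 * N)
    four = *-assoc 2 2 N

  -- All terms of the identity except the two lowest digits are even.
  parity-≡ : L ≡ L′
  parity-≡ = xor-false (begin
    L xor L′ ≡⟨ cong₂ _xor_ (odd-⟦⟧ L) (odd-⟦⟧ L′) ⟨
    odd ⟦ L ⟧ xor odd ⟦ L′ ⟧ ≡⟨ odd-+ ⟦ L ⟧ ⟦ L′ ⟧ ⟨
    odd (⟦ L ⟧ + ⟦ L′ ⟧) ≡⟨ xor-identityʳ _ ⟨
    odd (⟦ L ⟧ + ⟦ L′ ⟧) xor false ≡⟨ cong (odd (⟦ L ⟧ + ⟦ L′ ⟧) xor_) (odd-double X) ⟨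
    odd (⟦ L ⟧ + ⟦ L′ ⟧) xor odd (2 * X) ≡⟨ odd-+ (⟦ L ⟧ + ⟦ L′ ⟧) (2 * X) ⟨
    odd ((⟦ L ⟧ + ⟦ L′ ⟧) + 2 * X) ≡⟨ cong odd (trans equation four) ⟩
    odd (2 * (2 * N)) ≡⟨ odd-double (2 * N) ⟩
    false ∎)
    where
    open ≡-Reasoning
    X = E + (⟦ P ⟧ + ⟦ P′ ⟧) + 2 * (q + q′)

  -- When both lowest digits are 1 they add up to 2, so the identity can be halved; parity then
  -- relates the second digits and `E`.
  second-bit : L ∧ not P′ ≡ L ∧ (P xor odd E)
  second-bit = ∧-cong-true {L} λ p → odd-case p (trans (sym parity-≡) p)
    where
    X = E + (⟦ P ⟧ + ⟦ P′ ⟧) + 2 * (q + q′)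
    final : ∀ x y z → not (x xor (y xor z)) ≡ false → not z ≡ y xor x
    final false false true p = refl
    final false true false p = refl
    final true false false p = refl
    final true true true p = refl
    odd-case : L ≡ true → L′ ≡ true → not P′ ≡ P xor odd E
    odd-case l l′ = final (odd E) P P′ (begin
      not (odd E xor (P xor P′)) ≡⟨ cong (λ z → not (odd E xor z)) (cong₂ _xor_ (odd-⟦⟧ P) (odd-⟦⟧ P′)) ⟨
      not (odd E xor (odd ⟦ P ⟧ xor odd ⟦ P′ ⟧)) ≡⟨ cong (λ z → not (odd E xor z)) (odd-+ ⟦ P ⟧ ⟦ P′ ⟧) ⟨
      not (odd E xor odd (⟦ P ⟧ + ⟦ P′ ⟧)) ≡⟨ cong not (odd-+ E (⟦ P ⟧ + ⟦ P′ ⟧)) ⟨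
      not (odd (E + (⟦ P ⟧ + ⟦ P′ ⟧))) ≡⟨ cong not (xor-identityʳ _) ⟨
      not (odd (E + (⟦ P ⟧ + ⟦ P′ ⟧)) xor false) ≡⟨ cong (λ z → not (odd (E + (⟦ P ⟧ + ⟦ P′ ⟧)) xor z)) (odd-double (q + q′)) ⟨
      not (odd (E + (⟦ P ⟧ + ⟦ P′ ⟧)) xor odd (2 * (q + q′))) ≡⟨ cong not (odd-+ (E + (⟦ P ⟧ + ⟦ P′ ⟧)) (2 * (q + q′))) ⟨
      -- The 1 is half the sum of the two lowest digits.
      odd (1 + X) ≡⟨ cong odd (*-cancelˡ-≡ (1 + X) (2 * N) 2 (trans (*-distribˡ-+ 2 1 X) (trans two (trans equation four)))) ⟩
      odd (2 * N) ≡⟨ odd-double N ⟩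
      false ∎)
      where
      open ≡-Reasoning
      two : 2 + 2 * X ≡ (⟦ L ⟧ + ⟦ L′ ⟧) + 2 * X
      two = cong₂ (λ x y → (⟦ x ⟧ + ⟦ y ⟧) + 2 * X) (sym l) (sym l′)

-- Degrees and incidences

module Degrees (G : Graph) where
  open Graph G
  open Walks G

  incident-count : ∀ x e → ⟦ does (incident? G x e) ⟧ ≡ ⟦ tail e == x ⟧ + ⟦ head e == x ⟧
  incident-count x e with tail e ≟ x | head e ≟ x
  ... | yes p | yes q = ⊥-elim (loopless e (trans p (sym q)))
  ... | yes _ | no _ = refl
  ... | no _ | yes _ = refl
  ... | no _ | no _ = refl

  degree≡ : ∀ x → degree G x ≡ ℕΣ.sum (λ e → ⟦ does (incident? G x e) ⟧)
  degree≡ x = length-filter-tabulate (incident? G x) (λ e → e)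

  -- Double counting of incidences. With `k` the indicator of A, it sums the degrees over A.
  handshake : (k : Vertex G → ℕ) → ℕΣ.sum (λ x → k x * degree G x) ≡ ℕΣ.sum (λ e → k (tail e) + k (head e))
  handshake k = begin
    ℕΣ.sum (λ x → k x * degree G x)
      ≡⟨ ℕΣ.sum-cong-≗ (λ x → trans (cong (k x *_) (degree≡ x)) (ℕΣ.*-distribˡ-sum (k x) (λ e → ⟦ does (incident? G x e) ⟧))) ⟩
    ℕΣ.sum (λ x → ℕΣ.sum (λ e → k x * ⟦ does (incident? G x e) ⟧)) ≡⟨ ℕΣ.∑-comm (λ x e → k x * ⟦ does (incident? G x e) ⟧) ⟩
    ℕΣ.sum (λ e → ℕΣ.sum (λ x → k x * ⟦ does (incident? G x e) ⟧)) ≡⟨ ℕΣ.sum-cong-≗ {m} per-edge ⟩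
    ℕΣ.sum (λ e → k (tail e) + k (head e)) ∎
    where
    open ≡-Reasoning
    per-edge : ∀ e → ℕΣ.sum (λ x → k x * ⟦ does (incident? G x e) ⟧) ≡ k (tail e) + k (head e)
    per-edge e = begin
      ℕΣ.sum (λ x → k x * ⟦ does (incident? G x e) ⟧)
        ≡⟨ ℕΣ.sum-cong-≗ (λ x → trans (*-comm (k x) _) (trans (cong (_* k x) (incident-count x e)) (*-distribʳ-+ (k x) ⟦ tail e == x ⟧ _))) ⟩
      ℕΣ.sum (λ x → ⟦ tail e == x ⟧ * k x + ⟦ head e == x ⟧ * k x) ≡⟨ ℕΣ.∑-distrib-+ (λ x → ⟦ tail e == x ⟧ * k x) _ ⟩
      ℕΣ.sum (λ x → ⟦ tail e == x ⟧ * k x) + ℕΣ.sum (λ x → ⟦ head e == x ⟧ * k x)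
        ≡⟨ cong₂ _+_ (ℕΣ-indicator (tail e) k) (ℕΣ-indicator (head e) k) ⟩
      k (tail e) + k (head e) ∎

  -- The indicator of four distinct incident edges lies below the incidence indicator, and both have
  -- total 4, so `ℕΣ-tight` makes them equal.
  star : ∀ {x e₁ e₂ e₃ e₄} → degree G x ≡ 4 →
    Incident G x e₁ → Incident G x e₂ → Incident G x e₃ → Incident G x e₄ →
    e₁ ≢ e₂ → e₁ ≢ e₃ → e₁ ≢ e₄ → e₂ ≢ e₃ → e₂ ≢ e₄ → e₃ ≢ e₄ → (F : Edge G → ℕ) →
    ℕΣ.sum (λ e → ⟦ does (incident? G x e) ⟧ * F e) ≡ F e₁ + (F e₂ + (F e₃ + F e₄))
  star {x} {e₁} {e₂} {e₃} {e₄} deg i₁ i₂ i₃ i₄ n₁₂ n₁₃ n₁₄ n₂₃ n₂₄ n₃₄ F = begin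
    ℕΣ.sum (λ e → ⟦ does (incident? G x e) ⟧ * F e)
      ≡⟨ ℕΣ.sum-cong-≗ {m} (λ e → cong (_* F e) (ℕΣ-tight (λ e → ⟦ does (incident? G x e) ⟧) four four≤ total e)) ⟩
    ℕΣ.sum (λ e → four e * F e) ≡⟨ four-sum F ⟩
    F e₁ + (F e₂ + (F e₃ + F e₄)) ∎
    where
    open ≡-Reasoning
    four : Edge G → ℕ
    four e = ⟦ e₁ == e ⟧ + (⟦ e₂ == e ⟧ + (⟦ e₃ == e ⟧ + ⟦ e₄ == e ⟧))
    four-sum : ∀ F → ℕΣ.sum (λ e → four e * F e) ≡ F e₁ + (F e₂ + (F e₃ + F e₄))
    four-sum F = begin
      ℕΣ.sum (λ e → four e * F e) ≡⟨ ℕΣ.sum-cong-≗ {m} (λ e → distrib ⟦ e₁ == e ⟧ ⟦ e₂ == e ⟧ ⟦ e₃ == e ⟧ ⟦ e₄ == e ⟧ (F e)) ⟩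
      ℕΣ.sum (λ e → A₁ e + (A₂ e + (A₃ e + A₄ e)))
        ≡⟨ trans (ℕΣ.∑-distrib-+ A₁ (λ e → A₂ e + (A₃ e + A₄ e))) (cong (ℕΣ.sum A₁ +_)
           (trans (ℕΣ.∑-distrib-+ A₂ (λ e → A₃ e + A₄ e)) (cong (ℕΣ.sum A₂ +_) (ℕΣ.∑-distrib-+ A₃ A₄)))) ⟩
      ℕΣ.sum A₁ + (ℕΣ.sum A₂ + (ℕΣ.sum A₃ + ℕΣ.sum A₄))
        ≡⟨ cong₂ _+_ (ℕΣ-indicator e₁ F) (cong₂ _+_ (ℕΣ-indicator e₂ F) (cong₂ _+_ (ℕΣ-indicator e₃ F) (ℕΣ-indicator e₄ F))) ⟩
      F e₁ + (F e₂ + (F e₃ + F e₄)) ∎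
      where
      A₁ A₂ A₃ A₄ : Edge G → ℕ
      A₁ e = ⟦ e₁ == e ⟧ * F e
      A₂ e = ⟦ e₂ == e ⟧ * F e
      A₃ e = ⟦ e₃ == e ⟧ * F e
      A₄ e = ⟦ e₄ == e ⟧ * F e
      open +-*-Solver using (solve; _:+_; _:*_; _:=_; con)
      distrib : ∀ p q s t y → (p + (q + (s + t))) * y ≡ p * y + (q * y + (s * y + t * y))
      distrib = solve 5 (λ p q s t y → (p :+ (q :+ (s :+ t))) :* y := p :* y :+ (q :* y :+ (s :* y :+ t :* y))) refl
    one : ∀ {e} → Incident G x e → 1 ≤ ⟦ does (incident? G x e) ⟧
    one {e} i rewrite dec-true (incident? G x e) i = ≤-refl
    four≤ : ∀ e → four e ≤ ⟦ does (incident? G x e) ⟧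
    four≤ e with e₁ ≟ e | e₂ ≟ e | e₃ ≟ e | e₄ ≟ e
    ... | yes p | yes q | _ | _ = ⊥-elim (n₁₂ (trans p (sym q)))
    ... | yes p | _ | yes q | _ = ⊥-elim (n₁₃ (trans p (sym q)))
    ... | yes p | _ | _ | yes q = ⊥-elim (n₁₄ (trans p (sym q)))
    ... | _ | yes p | yes q | _ = ⊥-elim (n₂₃ (trans p (sym q)))
    ... | _ | yes p | _ | yes q = ⊥-elim (n₂₄ (trans p (sym q)))
    ... | _ | _ | yes p | yes q = ⊥-elim (n₃₄ (trans p (sym q)))
    ... | yes refl | no _ | no _ | no _ = one i₁
    ... | no _ | yes refl | no _ | no _ = one i₂
    ... | no _ | no _ | yes refl | no _ = one i₃
    ... | no _ | no _ | no _ | yes refl = one i₄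
    ... | no _ | no _ | no _ | no _ = z≤n
    total : ℕΣ.sum (λ e → ⟦ does (incident? G x e) ⟧) ≡ ℕΣ.sum four
    total = trans (sym (degree≡ x)) (trans deg (sym (trans (ℕΣ.sum-cong-≗ {m} λ e → sym (*-identityʳ (four e))) (four-sum λ _ → 1))))

  link-≢ : ∀ {g x y} → Link G g x y → x ≢ y
  link-≢ {g} (inj₁ (refl , refl)) = loopless g
  link-≢ {g} (inj₂ (refl , refl)) = loopless g ∘ sym

  link-incident : ∀ {g x y} → Link G g x y → Incident G x g
  link-incident (inj₁ (p , _)) = inj₁ p
  link-incident (inj₂ (_ , p)) = inj₂ p

  link-distinct : ∀ {g h x y z} → Link G g x y → Link G h x z → y ≢ z → g ≢ h
  link-distinct (inj₁ (refl , refl)) (inj₁ (_ , refl)) y≢z refl = y≢z refl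
  link-distinct (inj₂ (refl , refl)) (inj₂ (refl , _)) y≢z refl = y≢z refl
  link-distinct {g} (inj₁ (refl , refl)) (inj₂ (_ , q)) _ refl = loopless g (sym q)
  link-distinct {g} (inj₂ (refl , refl)) (inj₁ (p , _)) _ refl = loopless g p

-- The six special vertices as six bits

isolated : Bool → List Bool → Bool
isolated x []       = true
isolated x (y ∷ ys) = (y xor x) ∧ isolated x ys

-- The other bits are listed in the order of the vertex lists of the theorem, so that `R?≡` matches
-- them directly.
isolatedᵢ : Fin 6 → Vec Bool 6 → Bool
isolatedᵢ zero                               (a ∷ b ∷ c ∷ d ∷ e ∷ f ∷ []) = isolated a (b ∷ c ∷ d ∷ e ∷ f ∷ [])
isolatedᵢ (suc zero)                         (a ∷ b ∷ c ∷ d ∷ e ∷ f ∷ []) = isolated b (a ∷ c ∷ d ∷ e ∷ f ∷ [])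
isolatedᵢ (suc (suc zero))                   (a ∷ b ∷ c ∷ d ∷ e ∷ f ∷ []) = isolated c (a ∷ b ∷ d ∷ e ∷ f ∷ [])
isolatedᵢ (suc (suc (suc zero)))             (a ∷ b ∷ c ∷ d ∷ e ∷ f ∷ []) = isolated d (a ∷ b ∷ c ∷ e ∷ f ∷ [])
isolatedᵢ (suc (suc (suc (suc zero))))       (a ∷ b ∷ c ∷ d ∷ e ∷ f ∷ []) = isolated e (a ∷ b ∷ c ∷ d ∷ f ∷ [])
isolatedᵢ (suc (suc (suc (suc (suc zero))))) (a ∷ b ∷ c ∷ d ∷ e ∷ f ∷ []) = isolated f (a ∷ b ∷ c ∷ d ∷ e ∷ [])

-- Whether the number of true bits is 1 modulo 4.
one-mod4 : Vec Bool 6 → Bool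
one-mod4 u = sum (lookup u) ∧ not (pairs (lookup u))

by-enumeration : ∀ {m} (F H : Vec Bool m → Bool) → All.All (λ u → F u ≡ H u) (allVecs m) → ∀ u → F u ≡ H u
by-enumeration F H eq u = All.lookup eq (∈-allVecs u)

-- A count of six bits is 1 modulo 4 iff it is 1 or 5, that is, iff one bit differs from all the
-- others; no two bits can do so at once. Hence the sum here and the disjunction in `isolated-any`
-- agree. All 64 cases are evaluated.
isolated-xor : ∀ u → sum (λ i → isolatedᵢ i u) ≡ one-mod4 u
isolated-xor = by-enumeration _ _
  (toWitness {a? = All.all? (λ u → sum (λ i → isolatedᵢ i u) ≟ᵇ one-mod4 u) (allVecs 6)} _)

any₆ : (Fin 6 → Bool) → Bool
any₆ p = p zero ∨ p (suc zero) ∨ p (suc (suc zero)) ∨ p (suc (suc (suc zero)))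
       ∨ p (suc (suc (suc (suc zero)))) ∨ p (suc (suc (suc (suc (suc zero)))))

isolated-any : ∀ u → any₆ (λ i → isolatedᵢ i u) ≡ one-mod4 u
isolated-any = by-enumeration _ _
  (toWitness {a? = All.all? (λ u → any₆ (λ i → isolatedᵢ i u) ≟ᵇ one-mod4 u) (allVecs 6)} _)

∧-any₆ : ∀ s p → any₆ (λ i → s ∧ p i) ≡ s ∧ any₆ p
∧-any₆ false p = refl
∧-any₆ true p = refl

-- The degree count over A and the parity of the states

module Main (G : Graph) (regular : FourRegular G) {v w a b c d e f : Vertex G} {vw wa wb wc vd ve vf : Edge G}
  (lvw : Link G vw v w) (lwa : Link G wa w a) (lwb : Link G wb w b) (lwc : Link G wc w c)
  (lvd : Link G vd v d) (lve : Link G ve v e) (lvf : Link G vf v f)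
  (a≢b : a ≢ b) (a≢c : a ≢ c) (b≢c : b ≢ c) (d≢e : d ≢ e) (d≢f : d ≢ f) (e≢f : e ≢ f)
  (a≢v : a ≢ v) (b≢v : b ≢ v) (c≢v : c ≢ v) (d≢w : d ≢ w) (e≢w : e ≢ w) (f≢w : f ≢ w) where
  open Graph G
  open Deleted G v w
  open Walks G
  open Degrees G

  a∈R : VR a
  a∈R = a≢v , link-≢ lwa ∘ sym
  b∈R : VR b
  b∈R = b≢v , link-≢ lwb ∘ sym
  c∈R : VR c
  c∈R = c≢v , link-≢ lwc ∘ sym
  d∈R : VR d
  d∈R = link-≢ lvd ∘ sym , d≢w
  e∈R : VR e
  e∈R = link-≢ lve ∘ sym , e≢w
  f∈R : VR f
  f∈R = link-≢ lvf ∘ sym , f≢w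

  open Cuts G v w a a∈R
  open States G v w a b c a∈R b∈R c∈R a≢b a≢c b≢c

  at-w : ∀ F → ℕΣ.sum (λ i → ⟦ does (incident? G w i) ⟧ * F i) ≡ F vw + (F wa + (F wb + F wc))
  at-w = star (regular w) (link-incident lwv) (link-incident lwa) (link-incident lwb) (link-incident lwc)
      (link-distinct lwv lwa (a≢v ∘ sym)) (link-distinct lwv lwb (b≢v ∘ sym)) (link-distinct lwv lwc (c≢v ∘ sym))
      (link-distinct lwa lwb a≢b) (link-distinct lwa lwc a≢c) (link-distinct lwb lwc b≢c)
    where lwv = Link-sym lvw

  at-v : ∀ F → ℕΣ.sum (λ i → ⟦ does (incident? G v i) ⟧ * F i) ≡ F vw + (F vd + (F ve + F vf))
  at-v = star (regular v) (link-incident lvw) (link-incident lvd) (link-incident lve) (link-incident lvf)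
    (link-distinct lvw lvd (d≢w ∘ sym)) (link-distinct lvw lve (e≢w ∘ sym)) (link-distinct lvw lvf (f≢w ∘ sym))
    (link-distinct lvd lve d≢e) (link-distinct lvd lvf d≢f) (link-distinct lve lvf e≢f)

  sum-congᵥ : ∀ {p q : Vertex G → Bool} → (∀ x → p x ≡ q x) → sum p ≡ sum q
  sum-congᵥ = sum-cong-≗ {n}

  vr : Vertex G → Bool
  vr x = does (VR? x)

  -- `K ψ` is `true` at `v` and `w` as well, because the forest does not reach them; the restriction
  -- leaves the indicator of A.
  KR : Subset m → Vertex G → Bool
  KR ψ x = vr x ∧ K ψ x

  KR≡K : ∀ ψ {x} → VR x → KR ψ x ≡ K ψ x
  KR≡K ψ {x} x∈R = cong (_∧ K ψ x) (dec-true (VR? x) x∈R)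

  six : Vec (Vertex G) 6
  six = a ∷ b ∷ c ∷ d ∷ e ∷ f ∷ []

  bits : Subset m → Vec Bool 6
  bits ψ = K ψ a ∷ K ψ b ∷ K ψ c ∷ K ψ d ∷ K ψ e ∷ K ψ f ∷ []

  ∣A∣ : Subset m → Bool
  ∣A∣ ψ = sum (KR ψ)

  -- This is e(φ) = |A| - 1 modulo 2. In the tree φ + i each vertex of A is charged to the edges at
  -- it that separate it from the root. It has an odd number of these, while every edge of φ inside
  -- A, and also `i`, is charged oddly and all others evenly.
  forest-inside : ∀ {ψ i} → D ψ i ≡ true → sum (λ g → lookup (comp ψ) g ∧ inside ψ g) ≡ not (∣A∣ ψ)
  forest-inside {ψ} {i} state = flip-not (begin
    sum (KR ψ) ≡⟨ sum-congᵥ expand-vertex ⟩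
    sum (λ x → sum λ g → lookup T g ∧ (incidence g x ∧ μ g x)) ≡⟨ ∑-comm (λ x g → lookup T g ∧ (incidence g x ∧ μ g x)) ⟩
    sum (λ g → sum λ x → lookup T g ∧ (incidence g x ∧ μ g x)) ≡⟨ sum-congₑ per-edge ⟩
    sum (λ g → (lookup (comp ψ) g ∧ inside ψ g) xor (g == i)) ≡⟨ ∑-distrib-+ (λ g → lookup (comp ψ) g ∧ inside ψ g) (_== i) ⟩
    sum (λ g → lookup (comp ψ) g ∧ inside ψ g) xor sum (_== i)
      ≡⟨ cong (sum (λ g → lookup (comp ψ) g ∧ inside ψ g) xor_) (trans (sum-single i (_== i) (λ _ → ==-≢)) (==-refl i)) ⟩
    sum (λ g → lookup (comp ψ) g ∧ inside ψ g) xor true ∎)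
    where
    open ≡-Reasoning
    flip-not : ∀ {x y} → x ≡ y xor true → y ≡ not x
    flip-not {y = false} refl = refl
    flip-not {y = true} refl = refl
    tr = proj₁ (D⁻ state)
    i∈ = proj₁ (proj₂ (D⁻ state))
    trT = proj₂ (proj₂ (D⁻ state))
    T = σ i ψ
    incidence : Edge G → Vertex G → Bool
    incidence g x = (x == tail g) xor (x == head g)
    μ : Edge G → Vertex G → Bool
    μ g x = KR ψ x ∧ κ (T ∖ g) x
    expand-vertex : ∀ x → KR ψ x ≡ sum (λ g → lookup T g ∧ (incidence g x ∧ μ g x))
    expand-vertex x = begin
      KR ψ x ≡⟨ ∧-identityʳ _ ⟨
      KR ψ x ∧ true ≡⟨ ∧-cong-true {KR ψ x} (λ p → sym (path p)) ⟩
      KR ψ x ∧ sum (λ g → lookup T g ∧ (incidence g x ∧ κ (T ∖ g) x))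
        ≡⟨ *-distribˡ-sum (KR ψ x) (λ g → lookup T g ∧ (incidence g x ∧ κ (T ∖ g) x)) ⟩
      sum (λ g → KR ψ x ∧ (lookup T g ∧ (incidence g x ∧ κ (T ∖ g) x)))
        ≡⟨ sum-congₑ (λ g → inward (KR ψ x) (lookup T g) (incidence g x) (κ (T ∖ g) x)) ⟩
      sum (λ g → lookup T g ∧ (incidence g x ∧ μ g x)) ∎
      where
      inward : ∀ p q s t → p ∧ (q ∧ (s ∧ t)) ≡ q ∧ (s ∧ (p ∧ t))
      inward true q s t = refl
      inward false false s t = refl
      inward false true false t = refl
      inward false true true t = refl
      -- Expand the indicator of `x` along `T` at `x` itself; `x` is not the root, since `K ψ`
      -- vanishes there.
      path : KR ψ x ≡ true → sum (λ g → lookup T g ∧ (incidence g x ∧ κ (T ∖ g) x)) ≡ true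
      path p = trans (sym (expand trT (x ==_) (does⇒ (VR? x) (proj₁ (∧-true {vr x} p)))))
        (cong₂ _xor_ (==-refl x) (==-≢ {i = x} {a} λ { refl →
          false≢true (trans (sym (κ-root (comp ψ))) (proj₂ (∧-true {vr x} p))) }))
    indicator : ∀ y (k : Vertex G → Bool) → sum (λ x → (x == y) ∧ k x) ≡ k y
    indicator y k = trans (sum-single y (λ x → (x == y) ∧ k x) λ x x≢y → cong (_∧ k x) (==-≢ x≢y))
                          (cong (_∧ k y) (==-refl y))
    both-ends : ∀ g → sum (λ x → incidence g x ∧ μ g x) ≡ μ g (tail g) xor μ g (head g)
    both-ends g = trans (sum-congᵥ λ x → split (x == tail g) (x == head g) (μ g x))
      (trans (∑-distrib-+ (λ x → (x == tail g) ∧ μ g x) _) (cong₂ _xor_ (indicator (tail g) (μ g)) (indicator (head g) (μ g))))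
      where
      split : ∀ p q s → (p xor q) ∧ s ≡ (p ∧ s) xor (q ∧ s)
      split false q s = refl
      split true false s = sym (xor-identityʳ s)
      split true true s = sym (xor-same s)
    per-edge : ∀ g → sum (λ x → lookup T g ∧ (incidence g x ∧ μ g x)) ≡ (lookup (comp ψ) g ∧ inside ψ g) xor (g == i)
    per-edge g = trans (sym (*-distribˡ-sum (lookup T g) (λ x → incidence g x ∧ μ g x)))
                       (trans (cong (lookup T g ∧_) (both-ends g)) (evaluate g))
      where
      on-R : ∀ {g} → ER g → μ g (tail g) xor μ g (head g) ≡ (K ψ (tail g) ∧ κ (T ∖ g) (tail g)) xor (K ψ (head g) ∧ κ (T ∖ g) (head g))
      on-R {g} (p , q) = cong₂ (λ s t → (s ∧ κ (T ∖ g) (tail g)) xor (t ∧ κ (T ∖ g) (head g))) (KR≡K ψ p) (KR≡K ψ q)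
      evaluate : ∀ g → lookup T g ∧ (μ g (tail g) xor μ g (head g)) ≡ (lookup (comp ψ) g ∧ inside ψ g) xor (g == i)
      evaluate g with g ≟ i
      -- Without `i` the tree is φ, so `μ` reduces to `K ψ`, which changes across `i`: this is the
      -- one edge beyond those inside A.
      ... | yes refl = trans (cong₂ _∧_ (∈⇒true (f∈σ tr i∈)) (trans (on-R (proj₁ tr i i∈))
              (trans (cong (λ F → (K ψ (tail i) ∧ κ F (tail i)) xor (K ψ (head i) ∧ κ F (head i))) (σ∖ tr i∈))
                (trans (cong₂ _xor_ (∧-idem (K ψ (tail i))) (∧-idem (K ψ (head i)))) (K-crossing state)))))
            (cong (λ z → (z ∧ inside ψ i) xor true) (sym (∉⇒false (f∉comp tr i∈))))
      ... | no g≢i with lookup (comp ψ) g in eq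
      ...   | false = trans (cong (_∧ (μ g (tail g) xor μ g (head g))) (∉⇒false
                λ g∈T → [ g≢i , (λ q → false⇒∉ eq q) ]′ (∈-σ tr i∈ g∈T))) refl
      -- Exactly one end of `g` is cut off from the root, so the term is 1 iff `g` lies inside A.
      ...   | true = trans (cong₂ _∧_ (∈⇒true g∈T) (on-R (proj₁ (∈-comp {ψ} g∈))))
                (trans (product (K ψ (tail g)) (K ψ (head g)) _ _ (κ-const g∈) (cut trT g∈T)) (sym (xor-identityʳ (inside ψ g))))
        where
        g∈ = true⇒∈ {S = comp ψ} eq
        g∈T = comp⊆σ tr i∈ g∈
        product : ∀ k k′ p q → k xor k′ ≡ false → p xor q ≡ true → (k ∧ p) xor (k′ ∧ q) ≡ k ∧ k′
        product false false p q _ _ = refl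
        product true true p q _ r = r

  module Counting {ψ : Subset m} {i : Edge G} (state : D ψ i ≡ true) where
    k : Vertex G → ℕ
    k x = ⟦ KR ψ x ⟧
    kδ : Edge G → ℕ
    kδ g = k (tail g) + k (head g)

    tr = proj₁ (D⁻ state)

    k-outside : ∀ {x} → ¬ VR x → k x ≡ 0
    k-outside {x} ¬p = cong (λ z → ⟦ z ∧ K ψ x ⟧) (dec-false (VR? x) ¬p)

    kv≡0 : k v ≡ 0
    kv≡0 = k-outside λ p → proj₁ p refl
    kw≡0 : k w ≡ 0
    kw≡0 = k-outside λ p → proj₂ p refl

    kδ-link : ∀ {g x y} → Link G g x y → k x ≡ 0 → kδ g ≡ k y
    kδ-link {g} (inj₁ (refl , refl)) p = cong (_+ k (head g)) p
    kδ-link {g} (inj₂ (refl , refl)) p = trans (cong (k (tail g) +_) p) (+-identityʳ _)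

    k-inside : ∀ {x} → VR x → k x ≡ ⟦ K ψ x ⟧
    k-inside x∈R = cong ⟦_⟧ (KR≡K ψ x∈R)

    -- An edge joining `v` and `w` is counted twice, harmlessly, as `kδ` vanishes on it.
    outer : Edge G → ℕ
    outer g = ⟦ does (incident? G w g) ⟧ * kδ g + ⟦ does (incident? G v g) ⟧ * kδ g

    outer-sum : ℕΣ.sum outer ≡ ℕΣ.sum (⟦_⟧ ∘ lookup (bits ψ))
    outer-sum = begin
      ℕΣ.sum outer ≡⟨ ℕΣ.∑-distrib-+ (λ g → ⟦ does (incident? G w g) ⟧ * kδ g) _ ⟩
      ℕΣ.sum (λ g → ⟦ does (incident? G w g) ⟧ * kδ g) + ℕΣ.sum (λ g → ⟦ does (incident? G v g) ⟧ * kδ g)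
        ≡⟨ cong₂ _+_
             (trans (at-w kδ) (cong₂ _+_ (trans (kδ-link (Link-sym lvw) kw≡0) kv≡0) (cong₂ _+_ (value lwa kw≡0 a∈R) (cong₂ _+_ (value lwb kw≡0 b∈R) (value lwc kw≡0 c∈R)))))
             (trans (at-v kδ) (cong₂ _+_ (trans (kδ-link lvw kv≡0) kw≡0) (cong₂ _+_ (value lvd kv≡0 d∈R) (cong₂ _+_ (value lve kv≡0 e∈R) (value lvf kv≡0 f∈R))))) ⟩
      (⟦ K ψ a ⟧ + (⟦ K ψ b ⟧ + ⟦ K ψ c ⟧)) + (⟦ K ψ d ⟧ + (⟦ K ψ e ⟧ + ⟦ K ψ f ⟧))
        ≡⟨ solve 6 (λ a b c d e f → (a :+ (b :+ c)) :+ (d :+ (e :+ f)) := a :+ (b :+ (c :+ (d :+ (e :+ (f :+ con 0)))))) refl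
             ⟦ K ψ a ⟧ ⟦ K ψ b ⟧ ⟦ K ψ c ⟧ ⟦ K ψ d ⟧ ⟦ K ψ e ⟧ ⟦ K ψ f ⟧ ⟩
      ℕΣ.sum (⟦_⟧ ∘ lookup (bits ψ)) ∎
      where
      open ≡-Reasoning
      open +-*-Solver using (solve; _:+_; _:*_; _:=_; con)
      value : ∀ {g x y} → Link G g x y → k x ≡ 0 → VR y → kδ g ≡ ⟦ K ψ y ⟧
      value l p y∈R = trans (kδ-link l p) (k-inside y∈R)

    -- An edge of R with one end in A is an exchange edge, and one with both ends in A counts twice.
    -- Any other edge meets `v` or `w`, where `k` is zero.
    edge-split : ∀ g → kδ g ≡ ⟦ D ψ g ⟧ + 2 * ⟦ er g ∧ inside ψ g ⟧ + outer g
    edge-split g = by-membership (ER? g)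
     where
     by-membership : (g∈? : Dec (ER g)) → kδ g ≡ ⟦ D ψ g ⟧ + 2 * ⟦ does g∈? ∧ inside ψ g ⟧ + outer g
     by-membership (yes p@((t≢v , t≢w) , (h≢v , h≢w))) = begin
      kδ g ≡⟨ cong₂ _+_ (k-inside (proj₁ p)) (k-inside (proj₂ p)) ⟩
      ⟦ K ψ (tail g) ⟧ + ⟦ K ψ (head g) ⟧ ≡⟨ two-bits (K ψ (tail g)) (K ψ (head g)) ⟩
      ⟦ δ (K ψ) g ⟧ + 2 * ⟦ inside ψ g ⟧ ≡⟨ cong (λ z → ⟦ z ⟧ + 2 * ⟦ inside ψ g ⟧) crossing ⟨
      ⟦ D ψ g ⟧ + 2 * ⟦ inside ψ g ⟧ ≡⟨ +-identityʳ _ ⟨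
      ⟦ D ψ g ⟧ + 2 * ⟦ inside ψ g ⟧ + 0 ≡⟨ cong ((⟦ D ψ g ⟧ + 2 * ⟦ inside ψ g ⟧) +_) (cong₂ (λ y z → ⟦ y ⟧ * kδ g + ⟦ z ⟧ * kδ g)
          (dec-false (incident? G w g) [ t≢w , h≢w ]′) (dec-false (incident? G v g) [ t≢v , h≢v ]′)) ⟨
      ⟦ D ψ g ⟧ + 2 * ⟦ inside ψ g ⟧ + outer g ∎
      where
      open ≡-Reasoning
      two-bits : ∀ p q → ⟦ p ⟧ + ⟦ q ⟧ ≡ ⟦ p xor q ⟧ + 2 * ⟦ p ∧ q ⟧
      two-bits false q = sym (+-identityʳ ⟦ q ⟧)
      two-bits true false = refl
      two-bits true true = refl
      -- An edge of R outside ψ belongs to φ and does not leave A.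
      crossing : D ψ g ≡ δ (K ψ) g
      crossing with lookup ψ g in eq
      ... | true = trans (D-crossing state g) (cong (_∧ δ (K ψ) g) eq)
      ... | false = trans (D-crossing state g) (trans (cong (_∧ δ (K ψ) g) eq) (sym (κ-const (comp-∈ {ψ} p (false⇒∉ eq)))))
     by-membership (no ¬p) = begin
      kδ g ≡⟨ by-incidence (incident? G w g) (incident? G v g) ⟩
      outer g ≡⟨ cong (λ z → ⟦ z ⟧ + 0 + outer g) (¬-not λ q → ⊥-elim (¬p (proj₁ tr g (proj₁ (proj₂ (D⁻ q)))))) ⟨
      ⟦ D ψ g ⟧ + 0 + outer g ∎
      where
      open ≡-Reasoning
      both : Link G g w v → kδ g ≡ 1 * kδ g + 1 * kδ g
      both l = trans zero-sum (sym (cong (λ z → 1 * z + 1 * z) zero-sum))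
        where
        zero-sum : kδ g ≡ 0
        zero-sum = trans (kδ-link l kw≡0) kv≡0
      by-incidence : (w∈? : Dec (Incident G w g)) (v∈? : Dec (Incident G v g)) →
                     kδ g ≡ ⟦ does w∈? ⟧ * kδ g + ⟦ does v∈? ⟧ * kδ g
      by-incidence (yes _) (no _) = sym (trans (+-identityʳ _) (+-identityʳ _))
      by-incidence (no _) (yes _) = sym (+-identityʳ _)
      by-incidence (no ¬i) (no ¬j) = ⊥-elim (¬p ((¬j ∘ inj₁ , ¬i ∘ inj₁) , (¬j ∘ inj₂ , ¬i ∘ inj₂)))
      by-incidence (yes (inj₁ i)) (yes (inj₁ j)) = ⊥-elim (link-≢ lvw (trans (sym j) i))
      by-incidence (yes (inj₂ i)) (yes (inj₂ j)) = ⊥-elim (link-≢ lvw (trans (sym j) i))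
      by-incidence (yes (inj₁ i)) (yes (inj₂ j)) = both (inj₁ (i , j))
      by-incidence (yes (inj₂ i)) (yes (inj₁ j)) = both (inj₂ (j , i))

    -- The identity k + 2(e(ψ) + e(φ)) + s = 4|A|, from `handshake` with the indicator of A.
    degree-identity : ℕΣ.sum (⟦_⟧ ∘ D ψ) + 2 * ℕΣ.sum (λ g → ⟦ er g ∧ inside ψ g ⟧) + ℕΣ.sum (⟦_⟧ ∘ lookup (bits ψ)) ≡ 4 * ℕΣ.sum k
    degree-identity = sym (begin
      4 * ℕΣ.sum k ≡⟨ ℕΣ.*-distribˡ-sum 4 k ⟩
      ℕΣ.sum (λ x → 4 * k x) ≡⟨ ℕΣ.sum-cong-≗ {n} (λ x → trans (*-comm 4 (k x)) (cong (k x *_) (sym (regular x)))) ⟩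
      ℕΣ.sum (λ x → k x * degree G x) ≡⟨ handshake k ⟩
      ℕΣ.sum kδ ≡⟨ ℕΣ.sum-cong-≗ {m} edge-split ⟩
      ℕΣ.sum (λ g → ⟦ D ψ g ⟧ + 2 * ⟦ er g ∧ inside ψ g ⟧ + outer g) ≡⟨ ℕΣ.∑-distrib-+ (λ g → ⟦ D ψ g ⟧ + 2 * ⟦ er g ∧ inside ψ g ⟧) outer ⟩
      ℕΣ.sum (λ g → ⟦ D ψ g ⟧ + 2 * ⟦ er g ∧ inside ψ g ⟧) + ℕΣ.sum outer
        ≡⟨ cong₂ _+_ (trans (ℕΣ.∑-distrib-+ (⟦_⟧ ∘ D ψ) _) (cong (ℕΣ.sum (⟦_⟧ ∘ D ψ) +_)
             (sym (ℕΣ.*-distribˡ-sum 2 (λ g → ⟦ er g ∧ inside ψ g ⟧))))) outer-sum ⟩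
      _ ∎)
      where open ≡-Reasoning

    inside-split : sum (λ g → er g ∧ inside ψ g) ≡ sum (λ g → lookup ψ g ∧ inside ψ g) xor not (∣A∣ ψ)
    inside-split = trans (sum-congₑ at) (trans (∑-distrib-+ (λ g → lookup ψ g ∧ inside ψ g) _)
        (cong (sum (λ g → lookup ψ g ∧ inside ψ g) xor_) (forest-inside state)))
      where
      at : ∀ g → er g ∧ inside ψ g ≡ (lookup ψ g ∧ inside ψ g) xor (lookup (comp ψ) g ∧ inside ψ g)
      at g rewrite lookup∘tabulate (λ e → er e ∧ not (lookup ψ e)) g with lookup ψ g in eq
      ... | true rewrite er-true tr (proj₁ (proj₂ (D⁻ state))) eq = sym (xor-identityʳ _)
      ... | false = cong (_∧ inside ψ g) (sym (∧-identityʳ (er g)))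

    private
      qD = count-mod4 (D ψ)
      qS = count-mod4 (lookup (bits ψ))
      module M = Mod4 _ _ (ℕΣ.sum (λ g → ⟦ er g ∧ inside ψ g ⟧)) (ℕΣ.sum k) (proj₁ qD) (proj₁ qS)
        (sum (D ψ)) (pairs (D ψ)) (sum (lookup (bits ψ))) (pairs (lookup (bits ψ))) (proj₂ qD) (proj₂ qS) degree-identity

    state-parity : sum (D ψ) ≡ sum (lookup (bits ψ))
    state-parity = M.parity-≡

    state-mod4 : sum (D ψ) ∧ not (pairs (lookup (bits ψ))) ≡
                 sum (D ψ) ∧ (pairs (D ψ) xor (sum (λ g → lookup ψ g ∧ inside ψ g) xor not (∣A∣ ψ)))
    state-mod4 = trans M.second-bit (cong (λ z → sum (D ψ) ∧ (pairs (D ψ) xor z))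
      (trans (odd-ℕΣ (λ g → er g ∧ inside ψ g)) inside-split))

  open Counting using (state-parity; state-mod4)

  st? : ∀ ψ → Dec (∃ λ i → D ψ i ≡ true)
  st? ψ = any? λ i → D ψ i ≟ᵇ true

  st : Subset m → Bool
  st ψ = does (st? ψ)

  -- For a state this is `state-mod4` multiplied out; otherwise `D ψ` is identically false and every
  -- term vanishes.
  decompose : ∀ ψ → st ψ ∧ one-mod4 (bits ψ) ≡
    ((pairs (D ψ) ∧ sum (lookup (bits ψ))) xor (sum (D ψ) ∧ sum (λ g → lookup ψ g ∧ inside ψ g)))
      xor ((sum (D ψ) ∧ ∣A∣ ψ) xor sum (D ψ))
  decompose ψ = by-state (st? ψ)
   where
   by-state : (s? : Dec (∃ λ i → D ψ i ≡ true)) → does s? ∧ one-mod4 (bits ψ) ≡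
    ((pairs (D ψ) ∧ sum (lookup (bits ψ))) xor (sum (D ψ) ∧ sum (λ g → lookup ψ g ∧ inside ψ g)))
      xor ((sum (D ψ) ∧ ∣A∣ ψ) xor sum (D ψ))
   by-state (yes (i , p)) = trans (cong (_∧ not (pairs (lookup (bits ψ)))) (sym (state-parity p)))
        (trans (state-mod4 p) (trans (ring (sum (D ψ)) (pairs (D ψ)) (sum (λ g → lookup ψ g ∧ inside ψ g)) (∣A∣ ψ))
          -- In the term with C(k,2) alone, k is replaced by s of equal parity, which opens it to
          -- `sum-pairs` at each of the six vertices.
          (cong (λ z → ((pairs (D ψ) ∧ z) xor (sum (D ψ) ∧ sum (λ g → lookup ψ g ∧ inside ψ g))) xor ((sum (D ψ) ∧ ∣A∣ ψ) xor sum (D ψ)))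
            (state-parity p))))
    where
    ring : ∀ l p x y → l ∧ (p xor (x xor not y)) ≡ ((p ∧ l) xor (l ∧ x)) xor ((l ∧ y) xor l)
    ring false false x y = refl
    ring false true x y = refl
    ring true false x true = cong (x xor_) refl
    ring true false x false = refl
    ring true true false true = refl
    ring true true false false = refl
    ring true true true true = refl
    ring true true true false = refl
   by-state (no ¬p) = sym (cong₂ (λ p l → ((p ∧ sum (lookup (bits ψ))) xor (l ∧ sum (λ g → lookup ψ g ∧ inside ψ g))) xor ((l ∧ ∣A∣ ψ) xor l))
        pairs-none (sum-falseₑ none))
    where
    none : ∀ i → D ψ i ≡ false
    none i = ¬-not λ q → ⊥-elim (¬p (i , q))
    pairs-none : pairs (D ψ) ≡ false
    pairs-none = sum-falseₑ λ i → sum-falseₑ λ j →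
      trans (cong (λ z → i <₂ j ∧ (z ∧ D ψ j)) (none i)) (∧-zeroʳ (i <₂ j))

  six∈R : ∀ i → VR (lookup six i)
  six∈R zero = a∈R
  six∈R (suc zero) = b∈R
  six∈R (suc (suc zero)) = c∈R
  six∈R (suc (suc (suc zero))) = d∈R
  six∈R (suc (suc (suc (suc zero)))) = e∈R
  six∈R (suc (suc (suc (suc (suc zero))))) = f∈R

  even-states : Σᵥ (λ ψ → st ψ ∧ one-mod4 (bits ψ)) ≡ false
  even-states = begin
    Σᵥ (λ ψ → st ψ ∧ one-mod4 (bits ψ)) ≡⟨ Σᵥ-congₑ decompose ⟩
    Σᵥ (λ ψ → (A₁ ψ xor A₂ ψ) xor (A₃ ψ xor sum (D ψ))) ≡⟨ Σᵥ-xor (λ ψ → A₁ ψ xor A₂ ψ) _ ⟩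
    Σᵥ (λ ψ → A₁ ψ xor A₂ ψ) xor Σᵥ (λ ψ → A₃ ψ xor sum (D ψ)) ≡⟨ cong₂ _xor_ (Σᵥ-xor A₁ A₂) (Σᵥ-xor A₃ (λ ψ → sum (D ψ))) ⟩
    (Σᵥ A₁ xor Σᵥ A₂) xor (Σᵥ A₃ xor Σᵥ (λ ψ → sum (D ψ))) ≡⟨ cong₂ _xor_ (cong₂ _xor_ A₁-zero A₂-zero) (cong₂ _xor_ A₃-zero sum-states) ⟩
    false ∎
    where
    open ≡-Reasoning
    A₁ A₂ A₃ : Subset m → Bool
    A₁ ψ = pairs (D ψ) ∧ sum (lookup (bits ψ))
    A₂ ψ = sum (D ψ) ∧ sum (λ g → lookup ψ g ∧ inside ψ g)
    A₃ ψ = sum (D ψ) ∧ ∣A∣ ψ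
    A₁-zero : Σᵥ A₁ ≡ false
    A₁-zero = trans (Σᵥ-congₑ λ ψ → trans (*-distribˡ-sum (pairs (D ψ)) (lookup (bits ψ)))
                (sum-cong-≗ {6} λ i → cong (pairs (D ψ) ∧_) (lookup-map i (K ψ) six)))
              (trans (Σᵥ-sum (λ ψ i → pairs (D ψ) ∧ K ψ (lookup six i))) (sum-false {6} λ i → sum-pairs (six∈R i)))
    A₂-zero : Σᵥ A₂ ≡ false
    A₂-zero = trans (Σᵥ-congₑ λ ψ → *-distribʳ-sum (sum (λ g → lookup ψ g ∧ inside ψ g)) (D ψ)) sum-inside
    A₃-zero : Σᵥ A₃ ≡ false
    A₃-zero = trans (Σᵥ-congₑ λ ψ → *-distribˡ-sum (sum (D ψ)) (KR ψ))
      (trans (Σᵥ-sum (λ ψ x → sum (D ψ) ∧ KR ψ x)) (sum-false {n} at))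
      where
      at : ∀ x → Σᵥ (λ ψ → sum (D ψ) ∧ KR ψ x) ≡ false
      at x = by-membership (VR? x)
       where
       by-membership : (x∈? : Dec (VR x)) → Σᵥ (λ ψ → sum (D ψ) ∧ (does x∈? ∧ K ψ x)) ≡ false
       by-membership (yes x∈R) = trans (Σᵥ-congₑ λ ψ → *-distribʳ-sum (K ψ x) (D ψ)) (sum-separating x∈R)
       by-membership (no _) = trans (Σᵥ-congₑ λ ψ → ∧-zeroʳ (sum (D ψ))) (Σᵥ-false m)

  -- States and the sets of the theorem

  rest⇒comp : ∀ {ψ x y} → Reach G (Rest ψ) x y → Reach G (_∈ˢ comp ψ) x y
  rest⇒comp = Reach-map λ _ (p , q) → comp-∈ p q

  comp⇒rest : ∀ {ψ x y} → Reach G (_∈ˢ comp ψ) x y → Reach G (Rest ψ) x y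
  comp⇒rest = Reach-map λ _ → ∈-comp

  differ : ∀ {x y z : Bool} → x ≢ y → z ≢ x → z ≡ y
  differ {false} {false} p q = ⊥-elim (p refl)
  differ {false} {true} {false} p q = ⊥-elim (q refl)
  differ {false} {true} {true} p q = refl
  differ {true} {false} {false} p q = refl
  differ {true} {false} {true} p q = ⊥-elim (q refl)
  differ {true} {true} p q = ⊥-elim (p refl)

  -- The root lies in one of the two trees of φ, so `K ψ` separates their representatives `p` and
  -- `q`, and φ is bicolored.
  InR⇒ : ∀ {x y ys ψ} → InR (x ∷ []) (y ∷ ys) ψ →
    (∃ λ i → D ψ i ≡ true) × (∀ z → z ∈ₗ y ∷ ys → K ψ z ≢ K ψ x)
  InR⇒ {x} {y} {ys} {ψ} (tr , _ , ac , p , q , p∈R , q∈R , ¬pq , cover , to-p , to-q) =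
    crossing , λ z z∈ eq → Kp≢Kq (trans (sym (K-p x (here refl))) (trans (sym eq) (K-q z z∈)))
    where
    K-p : ∀ z → z ∈ₗ x ∷ [] → K ψ z ≡ K ψ p
    K-p z z∈ = κ-Reach (rest⇒comp (to-p z z∈))
    K-q : ∀ z → z ∈ₗ y ∷ ys → K ψ z ≡ K ψ q
    K-q z z∈ = κ-Reach (rest⇒comp (to-q z z∈))
    joined : ∀ {s t} → Reach G (Rest ψ) a s → K ψ s ≡ K ψ t → Reach G (Rest ψ) s t
    joined {s} {t} a-s eq = Reach-trans (Reach-sym a-s) (comp⇒rest (Reach-sym (κ-false
      (trans (sym eq) (trans (sym (κ-Reach (rest⇒comp a-s))) (κ-root (comp ψ)))))))
    Kp≢Kq : K ψ p ≢ K ψ q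
    Kp≢Kq eq with cover a a∈R
    ... | inj₁ a-p = ¬pq (joined a-p eq)
    ... | inj₂ a-q = ¬pq (Reach-sym (joined a-q (sym eq)))
    classes : ∀ {s t} → VR s → VR t → K ψ s ≡ K ψ t → Reach G (_∈ˢ comp ψ) s t
    classes {s} {t} s∈R t∈R eq with cover s s∈R | cover t t∈R
    ... | inj₁ s-p | inj₁ t-p = rest⇒comp (Reach-trans s-p (Reach-sym t-p))
    ... | inj₂ s-q | inj₂ t-q = rest⇒comp (Reach-trans s-q (Reach-sym t-q))
    ... | inj₁ s-p | inj₂ t-q = ⊥-elim (Kp≢Kq (trans (sym (κ-Reach (rest⇒comp s-p))) (trans eq (κ-Reach (rest⇒comp t-q)))))
    ... | inj₂ s-q | inj₁ t-p = ⊥-elim (Kp≢Kq (trans (sym (κ-Reach (rest⇒comp t-p))) (trans (sym eq) (κ-Reach (rest⇒comp s-q)))))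
    bicolored : Bicolored (comp ψ)
    bicolored = record
      { within  = λ i i∈ → proj₁ (∈-comp {ψ} i∈)
      ; acyclic = λ i i∈ s → ac i (∈-comp i∈) (Reach-map (λ _ (j∈ , j≢) → ∈-comp j∈ , j≢) s)
      ; class   = classes
      }
    -- A nonzero value of `K ψ` forces a nonzero term in its expansion along ψ: an edge of ψ leaving
    -- A, which serves as an exchange edge.
    crossing-from : ∀ {z} → VR z → K ψ z ≡ true → ∃ λ i → D ψ i ≡ true
    crossing-from {z} z∈R Kz
      with i , s ← sum-true⇒∃ _ (trans (sym (expand tr (K ψ) z∈R)) (cong₂ _xor_ Kz (κ-root (comp ψ))))
      with i∈ , t ← ∧-true {lookup ψ i} s = i , D⁺ tr (true⇒∈ i∈) (subst Tree (sym (σ≡ tr (true⇒∈ i∈)))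
        (Bicolored⇒Tree bicolored (proj₁ tr i (true⇒∈ i∈)) (proj₁ (∧-true {δ (K ψ) i} t))))
    crossing : ∃ λ i → D ψ i ≡ true
    crossing with K ψ p in Kp | K ψ q in Kq
    ... | true | _ = crossing-from p∈R Kp
    ... | false | true = crossing-from q∈R Kq
    ... | false | false = ⊥-elim (Kp≢Kq (trans Kp (sym Kq)))

  -- `x` and `y` themselves represent the two trees; with only two values of `K ψ`, whatever differs
  -- from `x` agrees with `y`.
  ⇒InR : ∀ {x y ys ψ} → VR x → VR y → (∀ z → z ∈ₗ ys → VR z) →
    (∃ λ i → D ψ i ≡ true) → (∀ z → z ∈ₗ y ∷ ys → K ψ z ≢ K ψ x) → InR (x ∷ []) (y ∷ ys) ψ
  ⇒InR {x} {y} {ys} {ψ} x∈R y∈R ys∈R (i , state) apart =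
    proj₁ (D⁻ state) , (λ _ → proj₁) ,
    (λ j (p , q) s → bi .Bicolored.acyclic j (comp-∈ p q) (Reach-map (λ _ ((p , q) , n) → comp-∈ p q , n) s)) ,
    x , y , x∈R , y∈R , (λ s → apart y (here refl) (sym (κ-Reach (rest⇒comp s)))) ,
    cover , (λ { _ (here refl) → here }) ,
    λ z z∈ → connect (z∈R z z∈) y∈R (differ (apart y (here refl) ∘ sym) (apart z z∈))
    where
    bi = comp-bicolored state
    z∈R : ∀ z → z ∈ₗ y ∷ ys → VR z
    z∈R z (here refl) = y∈R
    z∈R z (there z∈) = ys∈R z z∈
    connect : ∀ {s t} → VR s → VR t → K ψ s ≡ K ψ t → Reach G (Rest ψ) s t
    connect p q eq = comp⇒rest (bi .Bicolored.class p q eq)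
    cover : ∀ z → VR z → Reach G (Rest ψ) z x ⊎ Reach G (Rest ψ) z y
    cover z z∈R with K ψ z ≟ᵇ K ψ x
    ... | yes eq = inj₁ (connect z∈R x∈R eq)
    ... | no ne = inj₂ (connect z∈R y∈R (differ (apart y (here refl) ∘ sym) ne))

  isolated⁺ : ∀ (χ : Vertex G → Bool) x zs → (∀ z → z ∈ₗ zs → χ z ≢ χ x) → isolated (χ x) (map χ zs) ≡ true
  isolated⁺ χ x [] _ = refl
  isolated⁺ χ x (z ∷ zs) p = ∧-intro (xor-true (p z (here refl))) (isolated⁺ χ x zs λ y → p y ∘ there)

  isolated⁻ : ∀ (χ : Vertex G → Bool) x zs → isolated (χ x) (map χ zs) ≡ true → ∀ z → z ∈ₗ zs → χ z ≢ χ x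
  isolated⁻ χ x (z ∷ zs) p y y∈ eq with ∧-true {χ z xor χ x} p
  isolated⁻ χ x (z ∷ zs) p y (here refl) eq | q , _ =
    false≢true (trans (sym (trans (cong (_xor χ x) eq) (xor-same (χ x)))) q)
  isolated⁻ χ x (z ∷ zs) p y (there y∈) eq | _ , q = isolated⁻ χ x zs q y y∈ eq

  -- Decided through the state and the six bits, so that its Boolean value has the form needed for
  -- `one-mod4`.
  InR? : ∀ {x y ys} → VR x → VR y → All.All VR ys → ∀ ψ → Dec (InR (x ∷ []) (y ∷ ys) ψ)
  InR? {x} {y} {ys} x∈R y∈R ys∈R ψ = Dec-map
    (λ (s , p) → ⇒InR x∈R y∈R (λ z → All.lookup ys∈R) s (isolated⁻ (K ψ) x (y ∷ ys) p))
    (λ p → proj₁ (InR⇒ p) , isolated⁺ (K ψ) x (y ∷ ys) (proj₂ (InR⇒ p)))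
    (st? ψ ×-dec (isolated (K ψ x) (map (K ψ) (y ∷ ys)) ≟ᵇ true))

  does-InR? : ∀ {x y ys} (x∈R : VR x) (y∈R : VR y) (ys∈R : All.All VR ys) ψ →
    does (InR? x∈R y∈R ys∈R ψ) ≡ st ψ ∧ isolated (K ψ x) (map (K ψ) (y ∷ ys))
  does-InR? {x} {y} {ys} _ _ _ ψ = cong (st ψ ∧_) (does-≟true (isolated (K ψ x) (map (K ψ) (y ∷ ys))))
    where
    does-≟true : ∀ z → does (z ≟ᵇ true) ≡ z
    does-≟true false = refl
    does-≟true true = refl

  Ra Rb Rc Rd Re Rf U : Subset m → Set
  Ra = InR (a ∷ []) (b ∷ c ∷ d ∷ e ∷ f ∷ [])
  Rb = InR (b ∷ []) (a ∷ c ∷ d ∷ e ∷ f ∷ [])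
  Rc = InR (c ∷ []) (a ∷ b ∷ d ∷ e ∷ f ∷ [])
  Rd = InR (d ∷ []) (a ∷ b ∷ c ∷ e ∷ f ∷ [])
  Re = InR (e ∷ []) (a ∷ b ∷ c ∷ d ∷ f ∷ [])
  Rf = InR (f ∷ []) (a ∷ b ∷ c ∷ d ∷ e ∷ [])
  U ψ = Ra ψ ⊎ Rb ψ ⊎ Rc ψ ⊎ Rd ψ ⊎ Re ψ ⊎ Rf ψ

  Ra? : ∀ ψ → Dec (Ra ψ)
  Ra? = InR? a∈R b∈R (c∈R ∷ d∈R ∷ e∈R ∷ f∈R ∷ [])
  Rb? : ∀ ψ → Dec (Rb ψ)
  Rb? = InR? b∈R a∈R (c∈R ∷ d∈R ∷ e∈R ∷ f∈R ∷ [])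
  Rc? : ∀ ψ → Dec (Rc ψ)
  Rc? = InR? c∈R a∈R (b∈R ∷ d∈R ∷ e∈R ∷ f∈R ∷ [])
  Rd? : ∀ ψ → Dec (Rd ψ)
  Rd? = InR? d∈R a∈R (b∈R ∷ c∈R ∷ e∈R ∷ f∈R ∷ [])
  Re? : ∀ ψ → Dec (Re ψ)
  Re? = InR? e∈R a∈R (b∈R ∷ c∈R ∷ d∈R ∷ f∈R ∷ [])
  Rf? : ∀ ψ → Dec (Rf ψ)
  Rf? = InR? f∈R a∈R (b∈R ∷ c∈R ∷ d∈R ∷ e∈R ∷ [])

  R? : Fin 6 → Subset m → Bool
  R? zero                               ψ = does (Ra? ψ)
  R? (suc zero)                         ψ = does (Rb? ψ)
  R? (suc (suc zero))                   ψ = does (Rc? ψ)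
  R? (suc (suc (suc zero)))             ψ = does (Rd? ψ)
  R? (suc (suc (suc (suc zero))))       ψ = does (Re? ψ)
  R? (suc (suc (suc (suc (suc zero))))) ψ = does (Rf? ψ)

  R?≡ : ∀ ψ i → R? i ψ ≡ st ψ ∧ isolatedᵢ i (bits ψ)
  R?≡ ψ zero                               = does-InR? a∈R b∈R (c∈R ∷ d∈R ∷ e∈R ∷ f∈R ∷ []) ψ
  R?≡ ψ (suc zero)                         = does-InR? b∈R a∈R (c∈R ∷ d∈R ∷ e∈R ∷ f∈R ∷ []) ψ
  R?≡ ψ (suc (suc zero))                   = does-InR? c∈R a∈R (b∈R ∷ d∈R ∷ e∈R ∷ f∈R ∷ []) ψ
  R?≡ ψ (suc (suc (suc zero)))             = does-InR? d∈R a∈R (b∈R ∷ c∈R ∷ e∈R ∷ f∈R ∷ []) ψ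
  R?≡ ψ (suc (suc (suc (suc zero))))       = does-InR? e∈R a∈R (b∈R ∷ c∈R ∷ d∈R ∷ f∈R ∷ []) ψ
  R?≡ ψ (suc (suc (suc (suc (suc zero))))) = does-InR? f∈R a∈R (b∈R ∷ c∈R ∷ d∈R ∷ e∈R ∷ []) ψ

  U? : ∀ ψ → Dec (U ψ)
  U? ψ = Ra? ψ ⊎-dec Rb? ψ ⊎-dec Rc? ψ ⊎-dec Rd? ψ ⊎-dec Re? ψ ⊎-dec Rf? ψ

  any₆-cong : ∀ {p q : Fin 6 → Bool} → (∀ i → p i ≡ q i) → any₆ p ≡ any₆ q
  any₆-cong eq = cong₂ _∨_ (eq _) (cong₂ _∨_ (eq _) (cong₂ _∨_ (eq _) (cong₂ _∨_ (eq _) (cong₂ _∨_ (eq _) (eq _)))))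

  does-U? : ∀ ψ → does (U? ψ) ≡ st ψ ∧ one-mod4 (bits ψ)
  does-U? ψ = trans (any₆-cong {λ i → R? i ψ} (R?≡ ψ))
    (trans (∧-any₆ (st ψ) (λ i → isolatedᵢ i (bits ψ))) (cong (st ψ ∧_) (isolated-any (bits ψ))))

  -- The involution and the total count

  elements : List (Subset m)
  elements = filter U? (allVecs m)

  ∈-elements : ∀ ψ → (U ψ → ψ ∈ₗ elements) × (ψ ∈ₗ elements → U ψ)
  ∈-elements ψ = ∈-filter⁺ U? (∈-allVecs ψ) , λ p → proj₂ (∈-filter⁻ U? {xs = allVecs m} p)

  involution : Σ (Subset m → Subset m) λ ι → ∀ ψ → U ψ → U (ι ψ) × ι (ι ψ) ≡ ψ × ι ψ ≢ ψ
  involution = partner elements , λ ψ u →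
    let p , q , s = partner-involution elements elements-unique even (proj₁ (∈-elements ψ) u)
    in proj₂ (∈-elements (partner elements ψ)) p , q , s
    where
    elements-unique = filter⁺ U? (allVecs-unique m)
    even : odd (length elements) ≡ false
    even = trans (odd-length U? elements elements-unique ∈-elements) (trans (Σᵥ-congₑ does-U?) even-states)

  -- Each count has the parity of a sum over the cube; adding the six indicators pointwise gives
  -- `one-mod4` on the states by `isolated-xor`.
  even-total : ∀ k₁ k₂ k₃ k₄ k₅ k₆ → IsCount Ra k₁ → IsCount Rb k₂ → IsCount Rc k₃ → IsCount Rd k₄ →
               IsCount Re k₅ → IsCount Rf k₆ → 2 ∣ (k₁ + k₂ + k₃ + k₄ + k₅ + k₆)
  even-total k₁ k₂ k₃ k₄ k₅ k₆ c₁ c₂ c₃ c₄ c₅ c₆ = even⇒2∣ _ (begin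
    odd (k₁ + k₂ + k₃ + k₄ + k₅ + k₆)
      ≡⟨ cong odd (solve 6 (λ a b c d e f → a :+ b :+ c :+ d :+ e :+ f := a :+ (b :+ (c :+ (d :+ (e :+ (f :+ con 0)))))) refl k₁ k₂ k₃ k₄ k₅ k₆) ⟩
    odd (k₁ + (k₂ + (k₃ + (k₄ + (k₅ + (k₆ + 0))))))
      ≡⟨ more Ra? c₁ (more Rb? c₂ (more Rc? c₃ (more Rd? c₄ (more Re? c₅ (more Rf? c₆ refl))))) ⟩
    sum (λ i → Σᵥ (R? i)) ≡⟨ Σᵥ-sum (λ ψ i → R? i ψ) ⟨
    Σᵥ (λ ψ → sum (λ i → R? i ψ)) ≡⟨ Σᵥ-congₑ (λ ψ → trans (sum-cong-≗ {6} (R?≡ ψ)) (trans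
        (sym (*-distribˡ-sum (st ψ) (λ i → isolatedᵢ i (bits ψ)))) (cong (st ψ ∧_) (isolated-xor (bits ψ))))) ⟩
    Σᵥ (λ ψ → st ψ ∧ one-mod4 (bits ψ)) ≡⟨ even-states ⟩
    false ∎)
    where
    open ≡-Reasoning
    open +-*-Solver using (solve; _:+_; _:*_; _:=_; con)
    more : ∀ {P : Subset m → Set} (P? : ∀ ψ → Dec (P ψ)) {k l y} → IsCount P k → odd l ≡ y →
           odd (k + l) ≡ Σᵥ (λ ψ → does (P? ψ)) xor y
    more P? {l = l} (xs , un , mem , refl) refl = trans (odd-+ (length xs) l) (cong (_xor odd l) (odd-length P? xs un mem))

theorem5p8 : (G : Graph) → Connected G → FourRegular G →
    (v w a b c d e f : Fin (Graph.n G)) →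
    Adj G v w →
    (∀ u → Adj G w u → u ≡ v ⊎ u ≡ a ⊎ u ≡ b ⊎ u ≡ c) →
    Adj G w a → Adj G w b → Adj G w c →
    (∀ u → Adj G v u → u ≡ w ⊎ u ≡ d ⊎ u ≡ e ⊎ u ≡ f) →
    Adj G v d → Adj G v e → Adj G v f →
    a ≢ b → a ≢ c → a ≢ d → a ≢ e → a ≢ f →
    b ≢ c → b ≢ d → b ≢ e → b ≢ f →
    c ≢ d → c ≢ e → c ≢ f →
    d ≢ e → d ≢ f →
    e ≢ f →
    a ≢ v → b ≢ v → c ≢ v → d ≢ w → e ≢ w → f ≢ w →
    let open Deleted G v w
        U : Subset (Graph.m G) → Set
        U ψ = InR (a ∷ []) (b ∷ c ∷ d ∷ e ∷ f ∷ []) ψ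
            ⊎ InR (b ∷ []) (a ∷ c ∷ d ∷ e ∷ f ∷ []) ψ
            ⊎ InR (c ∷ []) (a ∷ b ∷ d ∷ e ∷ f ∷ []) ψ
            ⊎ InR (d ∷ []) (a ∷ b ∷ c ∷ e ∷ f ∷ []) ψ
            ⊎ InR (e ∷ []) (a ∷ b ∷ c ∷ d ∷ f ∷ []) ψ
            ⊎ InR (f ∷ []) (a ∷ b ∷ c ∷ d ∷ e ∷ []) ψ
    in (Σ (Subset (Graph.m G) → Subset (Graph.m G)) λ ι →
          ∀ ψ → U ψ → U (ι ψ) × ι (ι ψ) ≡ ψ × ι ψ ≢ ψ)
     × (∀ k₁ k₂ k₃ k₄ k₅ k₆ →
          IsCount (InR (a ∷ []) (b ∷ c ∷ d ∷ e ∷ f ∷ [])) k₁ →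
          IsCount (InR (b ∷ []) (a ∷ c ∷ d ∷ e ∷ f ∷ [])) k₂ →
          IsCount (InR (c ∷ []) (a ∷ b ∷ d ∷ e ∷ f ∷ [])) k₃ →
          IsCount (InR (d ∷ []) (a ∷ b ∷ c ∷ e ∷ f ∷ [])) k₄ →
          IsCount (InR (e ∷ []) (a ∷ b ∷ c ∷ d ∷ f ∷ [])) k₅ →
          IsCount (InR (f ∷ []) (a ∷ b ∷ c ∷ d ∷ e ∷ [])) k₆ →
          2 ∣ (k₁ + k₂ + k₃ + k₄ + k₅ + k₆))
theorem5p8 G _ regular v w a b c d e f (vw , lvw) _ (wa , lwa) (wb , lwb) (wc , lwc) _ (vd , lvd) (ve , lve) (vf , lvf)
  a≢b a≢c _ _ _ b≢c _ _ _ _ _ _ d≢e d≢f e≢f a≢v b≢v c≢v d≢w e≢w f≢w = involution , even-total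
  where
  open Main G regular lvw lwa lwb lwc lvd lve lvf a≢b a≢c b≢c d≢e d≢f e≢f a≢v b≢v c≢v d≢w e≢w f≢w
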